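{- Let $\pi = 1 \oplus \rho$, where $\rho$ starts with a descent (i.e. $\rho(1)>\rho(2)$) and $\rho$ has no decreasing bond, and suppose $\pi$ satisfies condition $(\ddagger)$: there is at least one entry of $\pi$ lying to the right of the entry of value $2$ whose value is less than the value of the leftmost entry of $\rho$ (i.e. less than $\pi(2)$). Then the class $\operatorname{Av}(\pi)$ is not deflatable.
   Context: A permutation $\alpha$ is contained in $\beta$ if $\beta$ has a subsequence in the same relative order as $\alpha$; a class is a set of permutations closed under taking contained permutations; $\operatorname{Av}(\pi)$ is the class of permutations not containing $\pi$. $1\oplus\rho$ denotes a new minimum entry placed before a copy of $\rho$. A bond of a permutation is a pair of entries in adjacent positions whose values differ by $1$; it is decreasing if they form the pattern $21$. An interval of a permutation is a set of entries whose positions and values each form a set of consecutive integers, the whole permutation not counting as an interval; a permutation is simple if all its intervals are single entries (so $1$, $12$, $21$ are simple). A class $\mathcal{C}$ is deflatable if there is a proper subclass $\mathcal{D}\subsetneq\mathcal{C}$ with $\mathcal{C}\subseteq\langle\mathcal{D}\rangle$, where the substitution closure $\langle\mathcal{D}\rangle$ is the largest class whose simple permutations are exactly those of $\mathcal{D}$; equivalently, $\mathcal{C}$ is not deflatable if and only if every permutation in $\mathcal{C}$ is contained in some simple permutation belonging to $\mathcal{C}$. -}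

module Defs where

open import Data.Nat using (ℕ; zero; suc; _+_; _<_; _≤_; _<?_)
open import Data.List using (List; []; _∷_; _++_; length; map; upTo; filter; take; drop)
open import Data.List.Relation.Binary.Permutation.Propositional using (_↭_)
open import Data.List.Relation.Binary.Sublist.Propositional using (_⊆_)
open import Data.List.Membership.Propositional using (_∈_)
open import Data.Product using (Σ; ∃; _×_; _,_)
open import Relation.Nullary using (¬_)
open import Relation.Binary.PropositionalEquality using (_≡_; _≢_)

IsPerm : List ℕ → Set
IsPerm xs = xs ↭ map suc (upTo (length xs))

rank : ℕ → List ℕ → ℕ
rank x xs = suc (length (filter (_<? x) xs))

st : List ℕ → List ℕ
st xs = map (λ x → rank x xs) xs

_≼_ : List ℕ → List ℕ → Set
α ≼ β = Σ (List ℕ) λ s → (s ⊆ β) × (st s ≡ α)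

IsClass : (List ℕ → Set) → Set
IsClass C = (∀ σ → C σ → IsPerm σ)
          × (∀ α β → C β → IsPerm α → α ≼ β → C α)

Av : List ℕ → List ℕ → Set
Av π σ = IsPerm σ × ¬ (π ≼ σ)

ConsecutiveValues : List ℕ → Set
ConsecutiveValues s = Σ ℕ λ m → s ↭ map (m +_) (upTo (length s))

IsSimple : List ℕ → Set
IsSimple σ = IsPerm σ × (1 ≤ length σ)
           × (∀ i k → length (take k (drop i σ)) < length σ
                    → ConsecutiveValues (take k (drop i σ))
                    → length (take k (drop i σ)) ≤ 1)

-- Substitution closure ⟨D⟩: the largest class whose simple permutations are
-- exactly those of D, i.e. the permutations all of whose simple
-- subpermutations lie in D.
SubstClosure : (List ℕ → Set) → List ℕ → Set
SubstClosure D σ = IsPerm σ × (∀ τ → IsSimple τ → τ ≼ σ → D τ)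

Deflatable : (List ℕ → Set) → Set₁
Deflatable C = Σ (List ℕ → Set) λ D →
    IsClass D
  × (∀ σ → D σ → C σ)
  × (Σ (List ℕ) λ σ → C σ × ¬ D σ)
  × (∀ σ → C σ → SubstClosure D σ)

oneSum : List ℕ → List ℕ
oneSum ρ = 1 ∷ map suc ρ

StartsWithDescent : List ℕ → Set
StartsWithDescent (a ∷ b ∷ _) = b < a
StartsWithDescent _ = ⊥'
  where open import Data.Empty renaming (⊥ to ⊥')

NoDecreasingBond : List ℕ → Set
NoDecreasingBond (x ∷ y ∷ rest) = (x ≢ suc y) × NoDecreasingBond (y ∷ rest)
NoDecreasingBond _ = ⊤'
  where open import Data.Unit renaming (⊤ to ⊤')

second : List ℕ → ℕ
second (_ ∷ b ∷ _) = b
second _ = 0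

Ddagger : List ℕ → Set
Ddagger π = Σ (List ℕ) λ xs → Σ (List ℕ) λ ys →
  (π ≡ xs ++ (2 ∷ ys)) × (Σ ℕ λ y → (y ∈ ys) × (y < second π))

{-# OPTIONS --safe #-}
module Submission where

-- It suffices to place every σ in Av(1 ⊕ ρ) below a simple permutation of Av(1 ⊕ ρ).
-- Adding left-to-right minima along the lower-left staircase never creates 1 ⊕ ρ, as long as
-- the entries to the upper right of each new minimum avoid ρ.  Put a minimum in every gap of
-- the staircase: each other entry then becomes a chord joining the gap of its position to the
-- gap of its value, and the permutation is simple as soon as the crossing graph of these
-- chords is connected.  Connectivity is achieved by scanning the chords from right to left:
-- a chord d that crosses no later one is linked to a later chord c by a new chord b crossing
-- both.  The entry b is placed next to c so that c b (or b c) is a decreasing bond in every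
-- copy of ρ containing both, while a copy of ρ containing b and d would give ρ(1) ≤ 2.
-- Neither is possible: ρ has no decreasing bond, and hence ρ(1) > ρ(2) + 1.

open import Defs
open import Data.Empty using (⊥; ⊥-elim)
open import Data.List using (List; []; _∷_; _++_; length; map; upTo; applyUpTo; filter; take; drop; concatMap; downFrom; initLast; _∷ʳ′_)
open import Data.List.Extrema.Nat using (max; xs≤max; argmin; argmax; argmin-sel; argmax-sel; f[argmin]≤f[xs]; f[xs]≤f[argmax]; f[⊥]≤f[argmax])
open import Data.List.Membership.Propositional using (_∈_; find; lose)
open import Data.List.Membership.Propositional.Properties
open import Data.List.Properties
open import Data.List.Relation.Binary.Permutation.Propositional using (_↭_; ↭-sym; ↭-trans; ↭-reflexive; ↭⇒↭ₛ)
open import Data.List.Relation.Binary.Permutation.Propositional.Properties using (∈-resp-↭; ↭-length; filter-↭) renaming (map⁺ to ↭-map⁺)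
import Data.List.Relation.Binary.Permutation.Setoid.Properties as PermS
open import Data.List.Relation.Binary.Sublist.Propositional as Sub using (_⊆_; []; _∷_; _∷ʳ_)
import Data.List.Relation.Binary.Sublist.Propositional.Properties as Sub
open import Data.List.Relation.Unary.All as All using (All; []; _∷_)
import Data.List.Relation.Unary.All.Properties as All
open import Data.List.Relation.Unary.AllPairs as AllPairs using (AllPairs; []; _∷_)
import Data.List.Relation.Unary.AllPairs.Properties as AllPairs
open import Data.List.Relation.Unary.Any as Any using (Any; here; there)
import Data.List.Relation.Unary.Any.Properties as Any
open import Data.List.Relation.Unary.Sorted.TotalOrder.Properties using (Sorted⇒AllPairs)
open import Data.List.Relation.Unary.Unique.Propositional using (Unique)
import Data.List.Relation.Unary.Unique.Propositional.Properties as Unique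
open import Data.Nat using (ℕ; zero; suc; _+_; _*_; _⊓_; _≤_; _<_; _<?_; _≟_; z≤n; s≤s; s≤s⁻¹)
open import Data.Nat.Properties
open import Data.List.Sort ≤-decTotalOrder using (sort; sort-↭; sort-↗)
open import Data.Product using (∃-syntax; _×_; _,_; proj₁; proj₂)
open import Data.Sum using (_⊎_; inj₁; inj₂; [_,_])
open import Data.Unit using (⊤; tt)
open import Function using (_∘_; id; _⇔_; mk⇔; Equivalence)
open import Relation.Binary using (tri<; tri≈; tri>)
open import Relation.Binary.PropositionalEquality hiding ([_])
open import Relation.Nullary using (¬_; Dec; yes; no; contradiction; _×-dec_; _⊎-dec_)

private
  variable
    A : Set

-- Standardization

below : ℕ → List ℕ → ℕ
below x xs = length (filter (_<? x) xs)

below-accept : ∀ {x y} ys → y < x → below x (y ∷ ys) ≡ suc (below x ys)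
below-accept {x} ys y<x = cong length (filter-accept (_<? x) {xs = ys} y<x)

below-reject : ∀ {x y} ys → ¬ y < x → below x (y ∷ ys) ≡ below x ys
below-reject {x} ys y≮x = cong length (filter-reject (_<? x) {xs = ys} y≮x)

below-++ : ∀ x xs ys → below x (xs ++ ys) ≡ below x xs + below x ys
below-++ x xs ys = trans (cong length (filter-++ (_<? x) xs ys)) (length-++ (filter (_<? x) xs))

below-cong : ∀ (f g : A → ℕ) {x y} xs → (∀ {a} → a ∈ xs → f a < x ⇔ g a < y) →
             below x (map f xs) ≡ below y (map g xs)
below-cong f g [] h = refl
below-cong f g {x} {y} (a ∷ xs) h with f a <? x
... | yes lt = trans (below-accept (map f xs) lt)
                 (trans (cong suc (below-cong f g xs (h ∘ there)))
                   (sym (below-accept (map g xs) (Equivalence.to (h (here refl)) lt))))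
... | no ¬lt = trans (below-reject (map f xs) ¬lt)
                 (trans (below-cong f g xs (h ∘ there))
                   (sym (below-reject (map g xs) (¬lt ∘ Equivalence.from (h (here refl))))))

below-∷ : ∀ x y ys → below x ys ≤ below x (y ∷ ys)
below-∷ x y ys with y <? x
... | yes y<x = ≤-trans (n≤1+n _) (≤-reflexive (sym (below-accept ys y<x)))
... | no y≮x = ≤-reflexive (sym (below-reject ys y≮x))

below-mono : ∀ {x y} xs → x ≤ y → below x xs ≤ below y xs
below-mono [] x≤y = z≤n
below-mono {x} {y} (a ∷ xs) x≤y with a <? x
... | yes a<x rewrite below-accept xs a<x | below-accept xs (<-≤-trans a<x x≤y) = s≤s (below-mono xs x≤y)
... | no a≮x rewrite below-reject xs a≮x = ≤-trans (below-mono xs x≤y) (below-∷ y a xs)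

below-mono-< : ∀ {x y} xs → x ∈ xs → x < y → below x xs < below y xs
below-mono-< {x} {y} (_ ∷ xs) (here refl) x<y
  rewrite below-reject xs (<-irrefl {x} refl) | below-accept xs x<y = s≤s (below-mono xs (<⇒≤ x<y))
below-mono-< {x} {y} (a ∷ xs) (there x∈) x<y with a <? x
... | yes a<x rewrite below-accept xs a<x | below-accept xs (<-trans a<x x<y) = s≤s (below-mono-< xs x∈ x<y)
... | no a≮x rewrite below-reject xs a≮x = <-≤-trans (below-mono-< xs x∈ x<y) (below-∷ y a xs)

below-none : ∀ {x} xs → (∀ {a} → a ∈ xs → ¬ a < x) → below x xs ≡ 0
below-none [] h = refl
below-none (a ∷ xs) h = trans (below-reject xs (h (here refl))) (below-none xs (h ∘ there))

rank-< : ∀ {w x y} → x ∈ w → x < y → rank x w < rank y w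
rank-< {w} x∈ x<y = s≤s (below-mono-< w x∈ x<y)

rank-cancel-< : ∀ {w x y} → y ∈ w → rank x w < rank y w → x < y
rank-cancel-< {w} {x} {y} y∈ lt with <-cmp x y
... | tri< x<y _ _ = x<y
... | tri≈ _ refl _ = contradiction lt (<-irrefl refl)
... | tri> _ _ y<x = contradiction lt (<-asym (rank-< {w} y∈ y<x))

rank-injective : ∀ {w x y} → x ∈ w → y ∈ w → rank x w ≡ rank y w → x ≡ y
rank-injective {w} {x} {y} x∈ y∈ eq with <-cmp x y
... | tri< x<y _ _ = contradiction eq (<⇒≢ (rank-< {w} x∈ x<y))
... | tri≈ _ x≡y _ = x≡y
... | tri> _ _ y<x = contradiction (sym eq) (<⇒≢ (rank-< {w} y∈ y<x))

st-cong : ∀ (f g : A → ℕ) xs → (∀ {a b} → a ∈ xs → b ∈ xs → f a < f b ⇔ g a < g b) →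
          st (map f xs) ≡ st (map g xs)
st-cong f g xs h = trans (sym (map-∘ xs)) (trans (map-cong-local (All.tabulate
  (λ b∈ → cong suc (below-cong f g xs (λ a∈ → h a∈ b∈))))) (map-∘ xs))

st-rank : ∀ {s w} → s ⊆ w → st (map (λ x → rank x w) s) ≡ st s
st-rank {s} {w} s⊆w = trans (st-cong (λ x → rank x w) id s
  (λ a∈ b∈ → mk⇔ (rank-cancel-< {w} (Sub.lookup s⊆w b∈)) (rank-< {w} (Sub.lookup s⊆w a∈))))
  (cong st (map-id s))

⊆-map⁻ : ∀ {B : Set} (f : A → B) {xs ys} → ys ⊆ map f xs → ∃[ zs ] zs ⊆ xs × ys ≡ map f zs
⊆-map⁻ f {[]} [] = [] , [] , refl
⊆-map⁻ f {x ∷ xs} (_ ∷ʳ τ) with zs , σ , eq ← ⊆-map⁻ f τ = zs , x ∷ʳ σ , eq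
⊆-map⁻ f {x ∷ xs} (refl ∷ τ) with zs , σ , eq ← ⊆-map⁻ f τ = x ∷ zs , refl ∷ σ , cong (f x ∷_) eq

≼-st⁺ : ∀ {s w} → s ⊆ w → st s ≼ st w
≼-st⁺ {s} {w} s⊆w = map (λ x → rank x w) s , Sub.map⁺ (λ x → rank x w) s⊆w , st-rank s⊆w

-- Ranks within `w` keep the order of every sublist, so containment in a standardized word can be
-- tested on the word itself.
≼-st⁻ : ∀ {α w} → α ≼ st w → ∃[ s ] s ⊆ w × st s ≡ α
≼-st⁻ {α} {w} (s , s⊆ , eq) with zs , zs⊆w , refl ← ⊆-map⁻ (λ x → rank x w) s⊆ =
  zs , zs⊆w , trans (sym (st-rank zs⊆w)) eq

st-increasing : ∀ {xs} → AllPairs _<_ xs → st xs ≡ map suc (upTo (length xs))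
st-increasing [] = refl
st-increasing {x ∷ xs} (x< ∷ inc) = cong₂ _∷_
  (cong suc (below-none (x ∷ xs) λ where
    (here refl) → <-irrefl refl
    (there a∈) a<x → <-asym a<x (All.lookup x< a∈)))
  (begin
    map (λ y → rank y (x ∷ xs)) xs  ≡⟨ map-cong-local (All.map (λ x<a → cong suc (below-accept xs x<a)) x<) ⟩
    map (λ y → suc (rank y xs)) xs  ≡⟨ map-∘ xs ⟩
    map suc (st xs)                 ≡⟨ cong (map suc) (st-increasing inc) ⟩
    map suc (map suc (upTo (length xs))) ≡⟨ cong (map suc) (map-upTo suc (length xs)) ⟩
    map suc (applyUpTo suc (length xs)) ∎)
  where open ≡-Reasoning

st-↭ : ∀ {xs ys} → xs ↭ ys → st xs ↭ st ys
st-↭ {xs} {ys} p = ↭-trans (↭-map⁺ _ p)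
  (↭-reflexive (map-cong (λ a → cong suc (↭-length (filter-↭ (_<? a) p))) ys))

strictly : ∀ {xs} → AllPairs _≤_ xs → Unique xs → AllPairs _<_ xs
strictly le ne = AllPairs.zipWith (λ (a , b) → ≤∧≢⇒< a b) (le , ne)

Unique-resp-↭ : ∀ {xs ys : List ℕ} → xs ↭ ys → Unique xs → Unique ys
Unique-resp-↭ p = PermS.Unique-resp-↭ (setoid ℕ) (↭⇒↭ₛ p)

-- Standardization commutes with reordering, so `w` may be sorted first; the ranks of an increasing
-- list are 1, 2, 3 and so on.
st-IsPerm : ∀ {w} → Unique w → IsPerm (st w)
st-IsPerm {w} u = ↭-trans (st-↭ (↭-sym (sort-↭ w))) (↭-reflexive
  (trans (st-increasing (strictly (Sorted⇒AllPairs ≤-totalOrder (sort-↗ w)) (Unique-resp-↭ (↭-sym (sort-↭ w)) u)))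
    (cong (map suc ∘ upTo) (trans (↭-length (sort-↭ w)) (sym (length-map (λ x → rank x w) w))))))

IsPerm⇒Unique : ∀ {w} → IsPerm w → Unique w
IsPerm⇒Unique p = Unique-resp-↭ (↭-sym p) (Unique.map⁺ suc-injective (Unique.upTo⁺ _))

-- Of the values 1, ..., n exactly k are below k + 1, so every value is its own rank.
IsPerm⇒st : ∀ {w} → IsPerm w → st w ≡ w
IsPerm⇒st {w} p = trans (map-cong-local (All.tabulate lem)) (map-id w)
  where
  count : ∀ n x → x ≤ n → below (suc x) (map suc (upTo n)) ≡ x
  count zero _ z≤n = refl
  count (suc n) zero x≤n = below-none (map suc (upTo (suc n))) λ a∈ a<1 →
    contradiction (pos a∈) (<⇒≱ a<1)
    where
    pos : ∀ {a m} → a ∈ map suc (upTo m) → 1 ≤ a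
    pos a∈ with _ , _ , refl ← ∈-map⁻ suc a∈ = s≤s z≤n
  count (suc n) (suc x) (s≤s x≤n) = trans (below-accept (map suc (applyUpTo suc n)) (s≤s (s≤s z≤n)))
    (cong suc (trans (cong (below (suc (suc x))) (cong (map suc) (sym (map-upTo suc n))))
      (trans (sym (below-cong id suc {suc x} (map suc (upTo n)) λ _ → mk⇔ s≤s λ where (s≤s q) → q))
        (trans (cong (below (suc x)) (map-id (map suc (upTo n)))) (count n x x≤n)))))
  lem : ∀ {a} → a ∈ w → rank a w ≡ a
  lem {a} a∈ with k , k∈ , refl ← ∈-map⁻ suc (∈-resp-↭ p a∈) =
    cong suc (trans (↭-length (filter-↭ (_<? suc k) p)) (count (length w) k (<⇒≤ (∈-upTo⁻ k∈))))

-- Simplicity of standardized words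

Convex : List ℕ → List ℕ → Set
Convex u w = ∀ {x y z} → x ∈ u → y ∈ u → z ∈ w → x < z → z < y → z ∈ u

-- Ranks preserve order, so a factor whose ranks form a block of consecutive integers contains every
-- entry of `w` whose value lies between two of its own.
st-IsSimple : ∀ {w} → Unique w → 1 ≤ length w →
  (∀ X u Y → w ≡ X ++ u ++ Y → Convex u w → 2 ≤ length u → length w ≤ length u) →
  IsSimple (st w)
st-IsSimple {w} uniq ne whole = st-IsPerm uniq , subst (1 ≤_) (sym len-st) ne , simple
  where
  r : ℕ → ℕ
  r x = rank x w
  len-st : length (st w) ≡ length w
  len-st = length-map r w
  simple : ∀ i k → length (take k (drop i (st w))) < length (st w) →
           ConsecutiveValues (take k (drop i (st w))) → length (take k (drop i (st w))) ≤ 1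
  simple i k short (m , perm)
    rewrite drop-map {f = r} i w | take-map {f = r} k (drop i w) | length-map r (take k (drop i w)) =
    ≮⇒≥ λ 2≤ → <⇒≱ (subst (length u <_) len-st short) (whole (take i w) u (drop k (drop i w)) split convex 2≤)
    where
    u = take k (drop i w)
    split : w ≡ take i w ++ u ++ drop k (drop i w)
    split = sym (trans (cong (take i w ++_) (take++drop≡id k (drop i w))) (take++drop≡id i w))
    u⊆w : ∀ {x} → x ∈ u → x ∈ w
    u⊆w x∈ = subst (_ ∈_) (sym split) (∈-++⁺ʳ (take i w) (∈-++⁺ˡ x∈))
    range : ∀ {x} → x ∈ u → m ≤ r x × r x < m + length u
    range x∈ with c , c∈ , eq ← ∈-map⁻ (m +_) (∈-resp-↭ perm (∈-map⁺ r x∈)) rewrite eq =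
      m≤m+n m c , +-monoʳ-< m (∈-upTo⁻ c∈)
    unrange : ∀ {z} → m ≤ z → z < m + length u → z ∈ map r u
    unrange {z} lo hi = ∈-resp-↭ (↭-sym perm) (subst (_∈ _) (m+[n∸m]≡n lo)
      (∈-map⁺ (m +_) (∈-upTo⁺ (+-cancelˡ-< m _ _ (subst (_< m + length u) (sym (m+[n∸m]≡n lo)) hi)))))
    convex : Convex u w
    convex {x} {y} {z} x∈ y∈ z∈ x<z z<y
      with z' , z'∈ , eq ← ∈-map⁻ r (unrange {r z}
          (≤-trans (proj₁ (range x∈)) (<⇒≤ (rank-< {w} (u⊆w x∈) x<z)))
          (<-trans (rank-< {w} z∈ z<y) (proj₂ (range y∈))))
      = subst (_∈ u) (sym (rank-injective {w} z∈ (u⊆w z'∈) eq)) z'∈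

-- Decreasing bonds, replacement of an entry, and the shape of 1 ⊕ ρ

no-bond-inside : ∀ xs {x y ys} → NoDecreasingBond (xs ++ x ∷ y ∷ ys) → x ≢ suc y
no-bond-inside [] (x≢ , _) = x≢
no-bond-inside (_ ∷ []) (_ , nb) = no-bond-inside [] nb
no-bond-inside (_ ∷ x' ∷ xs) (_ , nb) = no-bond-inside (x' ∷ xs) nb

rank-suc : ∀ xs {x y} ys → y < x → (∀ {a} → a ∈ xs ⊎ a ∈ ys → a < x → a < y) →
           rank x (xs ++ x ∷ y ∷ ys) ≡ suc (rank y (xs ++ x ∷ y ∷ ys))
rank-suc xs {x} {y} ys y<x adj = cong suc (begin
  below x (xs ++ x ∷ y ∷ ys)           ≡⟨ below-++ x xs _ ⟩
  below x xs + below x (x ∷ y ∷ ys)    ≡⟨ cong₂ _+_ (same xs inj₁) (trans (below-reject {x} {x} (y ∷ ys) (<-irrefl refl)) (below-accept {x} {y} ys y<x)) ⟩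
  below y xs + suc (below x ys)        ≡⟨ +-suc (below y xs) _ ⟩
  suc (below y xs + below x ys)        ≡⟨ cong (λ n → suc (below y xs + n)) (same ys inj₂) ⟩
  suc (below y xs + below y ys)        ≡⟨ cong (λ n → suc (below y xs + n)) (trans (below-reject {y} {x} (y ∷ ys) (<-asym y<x)) (below-reject {y} {y} ys (<-irrefl refl))) ⟨
  suc (below y xs + below y (x ∷ y ∷ ys)) ≡⟨ cong suc (below-++ y xs _) ⟨
  suc (below y (xs ++ x ∷ y ∷ ys))     ∎)
  where
  open ≡-Reasoning
  same : ∀ zs → (∀ {a} → a ∈ zs → a ∈ xs ⊎ a ∈ ys) → below x zs ≡ below y zs
  same zs sub = subst₂ _≡_ (cong (below x) (map-id zs)) (cong (below y) (map-id zs))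
    (below-cong id id zs λ a∈ → mk⇔ (adj (sub a∈)) (λ a<y → <-trans a<y y<x))

-- With no other value between `y` and `x`, the two ranks are consecutive, and the adjacent pair
-- standardizes to a decreasing bond.
bond-free : ∀ xs {x y} ys → NoDecreasingBond (st (xs ++ x ∷ y ∷ ys)) → y < x →
            ¬ (∀ {a} → a ∈ xs ⊎ a ∈ ys → a < x → a < y)
bond-free xs {x} {y} ys nb y<x adj =
  no-bond-inside (map r xs) (subst NoDecreasingBond (map-++ r xs (x ∷ y ∷ ys)) nb) (rank-suc xs ys y<x adj)
  where
  r : ℕ → ℕ
  r z = rank z (xs ++ x ∷ y ∷ ys)

st-replace : ∀ xs {x y} ys → (∀ {a} → a ∈ xs ⊎ a ∈ ys → (a < x ⇔ a < y) × (x < a ⇔ y < a)) →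
             st (xs ++ x ∷ ys) ≡ st (xs ++ y ∷ ys)
st-replace xs {x} {y} ys same = begin
  st (xs ++ x ∷ ys)   ≡⟨ cong st (side proj₁ refl λ _ → refl) ⟨
  st (map proj₁ zs)   ≡⟨ st-cong proj₁ proj₂ zs (λ a∈ b∈ → cmp (split a∈) (split b∈)) ⟩
  st (map proj₂ zs)   ≡⟨ cong st (side proj₂ refl λ _ → refl) ⟩
  st (xs ++ y ∷ ys)   ∎
  where
  open ≡-Reasoning
  -- Each entry is paired with its counterpart in the other list, so that both lists are images of
  -- the one list `zs`.
  dup : ℕ → ℕ × ℕ
  dup a = a , a
  zs = map dup xs ++ (x , y) ∷ map dup ys
  side : ∀ (f : ℕ × ℕ → ℕ) {z} → f (x , y) ≡ z → (∀ a → f (dup a) ≡ a) → map f zs ≡ xs ++ z ∷ ys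
  side f refl fd = trans (map-++ f (map dup xs) _) (cong₂ (λ p q → p ++ f (x , y) ∷ q) (undup xs) (undup ys))
    where
    undup : ∀ as → map f (map dup as) ≡ as
    undup as = trans (sym (map-∘ as)) (trans (map-cong fd as) (map-id as))
  Cases : ℕ × ℕ → Set
  Cases z = z ≡ (x , y) ⊎ (∃[ a ] z ≡ dup a × (a ∈ xs ⊎ a ∈ ys))
  split : ∀ {z} → z ∈ zs → Cases z
  split z∈ with ∈-++⁻ (map dup xs) z∈
  ... | inj₁ p with a , a∈ , eq ← ∈-map⁻ dup p = inj₂ (a , eq , inj₁ a∈)
  ... | inj₂ (here eq) = inj₁ eq
  ... | inj₂ (there p) with a , a∈ , eq ← ∈-map⁻ dup p = inj₂ (a , eq , inj₂ a∈)
  cmp : ∀ {a b} → Cases a → Cases b → proj₁ a < proj₁ b ⇔ proj₂ a < proj₂ b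
  cmp (inj₁ refl) (inj₁ refl) = mk⇔ (⊥-elim ∘ <-irrefl refl) (⊥-elim ∘ <-irrefl refl)
  cmp (inj₁ refl) (inj₂ (_ , refl , b∈)) = proj₂ (same b∈)
  cmp (inj₂ (_ , refl , a∈)) (inj₁ refl) = proj₁ (same a∈)
  cmp (inj₂ (_ , refl , _)) (inj₂ (_ , refl , _)) = mk⇔ id id

st-oneSum⁺ : ∀ {m s} → (∀ {a} → a ∈ s → m < a) → st (m ∷ s) ≡ oneSum (st s)
st-oneSum⁺ {m} {s} m< = cong₂ _∷_
  (cong suc (below-none (m ∷ s) λ where
    (here refl) → <-irrefl refl
    (there a∈) a<m → <-asym a<m (m< a∈)))
  (trans (map-cong-local (All.tabulate λ a∈ → cong suc (below-accept s (m< a∈)))) (map-∘ s))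

-- The first entry has rank 1, so nothing is smaller than it, and uniqueness excludes ties.
st-oneSum⁻ : ∀ {w ρ} → Unique w → st w ≡ oneSum ρ →
             ∃[ m ] ∃[ s ] w ≡ m ∷ s × (∀ {a} → a ∈ s → m < a) × st s ≡ ρ
st-oneSum⁻ {m ∷ s} {ρ} (m∉ ∷ _) eq = m , s , refl , m< ,
  map-injective suc-injective (∷-injectiveʳ (trans (sym (st-oneSum⁺ m<)) eq))
  where
  m< : ∀ {a} → a ∈ s → m < a
  m< {a} a∈ with <-cmp m a
  ... | tri< m<a _ _ = m<a
  ... | tri≈ _ m≡a _ = contradiction m≡a (All.lookup m∉ a∈)
  ... | tri> _ _ a<m = contradiction
    (subst (rank a (m ∷ s) <_) (∷-injectiveˡ eq) (rank-< {m ∷ s} (there a∈) a<m)) (<⇒≱ (s≤s (s≤s z≤n)))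

-- Lists sorted by a strictly decreasing key

AllPairs-⊆ : ∀ {R : A → A → Set} {xs ys} → xs ⊆ ys → AllPairs R ys → AllPairs R xs
AllPairs-⊆ [] [] = []
AllPairs-⊆ (_ ∷ʳ τ) (_ ∷ r) = AllPairs-⊆ τ r
AllPairs-⊆ (refl ∷ τ) (h ∷ r) = Sub.All-resp-⊆ τ h ∷ AllPairs-⊆ τ r

AllPairs-across : ∀ {R : A → A → Set} xs {ys} → AllPairs R (xs ++ ys) → ∀ {x y} → x ∈ xs → y ∈ ys → R x y
AllPairs-across (_ ∷ xs) (h ∷ _) (here refl) y∈ = All.lookup h (∈-++⁺ʳ xs y∈)
AllPairs-across (_ ∷ xs) (_ ∷ r) (there x∈) y∈ = AllPairs-across xs r x∈ y∈

Descending : (A → ℕ) → List A → Set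
Descending f = AllPairs (λ a b → f b < f a)

-- Two lists sorted by the same strict key agree on the order of common elements, so membership
-- alone yields a sublist.
descending-⊆ : ∀ (f : A → ℕ) {xs ys} → Descending f xs → Descending f ys →
               (∀ {x} → x ∈ xs → x ∈ ys) → xs ⊆ ys
descending-⊆ f {[]} {ys} dx dy sub = Sub.minimum ys
descending-⊆ f {x ∷ xs} {[]} dx dy sub with () ← sub (here refl)
descending-⊆ f {x ∷ xs} {y ∷ ys} (x> ∷ dx) (y> ∷ dy) sub with sub (here refl)
... | here refl = refl ∷ descending-⊆ f dx dy λ a∈ → later a∈ (sub (there a∈))
  where
  later : ∀ {a} → a ∈ xs → a ∈ x ∷ ys → a ∈ ys
  later a∈ (here refl) = contradiction (All.lookup x> a∈) (<-irrefl refl)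
  later a∈ (there p) = p
... | there x∈ = y ∷ʳ descending-⊆ f (x> ∷ dx) dy λ a∈ → later a∈ (sub a∈)
  where
  later : ∀ {a} → a ∈ x ∷ xs → a ∈ y ∷ ys → a ∈ ys
  later (here refl) _ = x∈
  later (there a∈) (here refl) = contradiction (<-trans (All.lookup x> a∈) (All.lookup y> x∈)) (<-irrefl refl)
  later (there a∈) (there p) = p

descending⇒unique : ∀ (f g : A → ℕ) {xs} → Descending f xs →
  (∀ {x y} → x ∈ xs → y ∈ xs → g x ≡ g y → x ≡ y) → Unique (map g xs)
descending⇒unique f g [] inj = []
descending⇒unique f g (x> ∷ d) inj =
  All.map⁺ (All.tabulate λ y∈ eq → <⇒≢ (All.lookup x> y∈) (cong f (sym (inj (here refl) (there y∈) eq)))) ∷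
  descending⇒unique f g d (λ y∈ z∈ → inj (there y∈) (there z∈))

map≡++ : ∀ {B : Set} (f : A → B) ws xs {ys} → map f ws ≡ xs ++ ys →
         ∃[ as ] ∃[ bs ] ws ≡ as ++ bs × map f as ≡ xs × map f bs ≡ ys
map≡++ f ws [] eq = [] , ws , refl , refl , eq
map≡++ f (w ∷ ws) (x ∷ xs) eq with as , bs , refl , refl , eq' ← map≡++ f ws xs (∷-injectiveʳ eq) =
  w ∷ as , bs , refl , cong (_∷ map f as) (∷-injectiveˡ eq) , eq'

-- Chord diagrams

-- Endpoints count gaps of the staircase of minima from its lower right end: the entry (p , v)
-- moves to the left as p grows and upwards as v grows, and it lies to the upper right of some
-- minimum because p < v.
Chord : Set
Chord = ℕ × ℕ

p v : Chord → ℕ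
p = proj₁
v = proj₂

-- Positions grow to the left, so reading order is descending `p`. Together the fields make all
-- endpoints distinct.
record Valid (E : List Chord) : Set where
  field
    descending : Descending p E
    p<v : ∀ {a} → a ∈ E → p a < v a
    p≢v : ∀ {a b} → a ∈ E → b ∈ E → p a ≢ v b
    v-inj : ∀ {a b} → a ∈ E → b ∈ E → v a ≡ v b → a ≡ b

Clique : List Chord → Set
Clique s = ∀ {a b} → a ∈ s → b ∈ s → p a < v b

-- The chords of a clique span a common gap, so a minimum put there lies to the lower left of
-- all their entries.
Good : List ℕ → List Chord → Set
Good ρ E = ∀ {s} → s ⊆ E → Clique s → st (map v s) ≢ ρ

Crosses : Chord → Chord → Set
Crosses a b = p b < p a × p a < v b × v b < v a

-- Every chord but the last crosses a later one. This forces a connected crossing graph, in a form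
-- that can be built up from the right.
Chained : List Chord → Set
Chained [] = ⊤
Chained (a ∷ E) = (E ≡ [] ⊎ Any (Crosses a) E) × Chained E

-- A minimum follows every endpoint except the largest.
Emits : List Chord → ℕ → Set
Emits E e = Any (λ c → p c ≡ e ⊎ v c ≡ e) E × Any (λ c → e < v c) E

emits? : ∀ E e → Dec (Emits E e)
emits? E e = Any.any? (λ c → (p c ≟ e) ⊎-dec (v c ≟ e)) E ×-dec Any.any? (λ c → e <? v c) E

-- inj₁ e is the minimum between the endpoint e and the next larger one.
Point : Set
Point = ℕ ⊎ Chord

-- Doubling reserves the odd numbers for the minima. A minimum has equal coordinates; as positions
-- count from the right, the minima form a decreasing staircase.
posn val : Point → ℕ
posn (inj₁ e) = suc (2 * e)
posn (inj₂ c) = 2 * p c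
val (inj₁ e) = suc (2 * e)
val (inj₂ c) = 2 * v c

≤⇒even<odd : ∀ {a b} → a ≤ b → 2 * a < suc (2 * b)
≤⇒even<odd a≤b = s≤s (*-monoʳ-≤ 2 a≤b)

even<odd⇒≤ : ∀ {a b} → 2 * a < suc (2 * b) → a ≤ b
even<odd⇒≤ lt = *-cancelˡ-≤ 2 (s≤s⁻¹ lt)

<⇒odd<even : ∀ {a b} → a < b → suc (2 * a) < 2 * b
<⇒odd<even {a} {b} a<b = subst (_≤ 2 * b) (*-suc 2 a) (*-monoʳ-≤ 2 a<b)

odd<even⇒< : ∀ {a b} → suc (2 * a) < 2 * b → a < b
odd<even⇒< {a} {b} lt = *-cancelˡ-< 2 a b (<-trans (n<1+n _) lt)

<⇒odd<odd : ∀ {a b} → a < b → suc (2 * a) < suc (2 * b)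
<⇒odd<odd a<b = s≤s (*-monoʳ-< 2 a<b)

odd<odd⇒< : ∀ {a b} → suc (2 * a) < suc (2 * b) → a < b
odd<odd⇒< {a} {b} lt = *-cancelˡ-< 2 a b (s≤s⁻¹ lt)

even<even⇒< : ∀ {a b} → 2 * a < 2 * b → a < b
even<even⇒< {a} {b} = *-cancelˡ-< 2 a b

-- The minimum has position 2e + 1 and the chord 2e, so the minimum is read first.
at : List Chord → ℕ → List Point
at E e = map inj₁ (filter (emits? E) (e ∷ [])) ++ map inj₂ (filter (λ c → p c ≟ e) E)

st-double : ∀ s → st (map (2 *_) s) ≡ st s
st-double s = trans (st-cong (2 *_) id s (λ _ _ → mk⇔ even<even⇒< (*-monoʳ-< 2))) (cong st (map-id s))

all-chords : ∀ zs → (∀ {z} → z ∈ zs → ∃[ c ] z ≡ inj₂ c) → ∃[ cs ] zs ≡ map {B = Point} inj₂ cs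
all-chords [] h = [] , refl
all-chords (z ∷ zs) h with c , refl ← h (here refl) | cs , refl ← all-chords zs (h ∘ there) = c ∷ cs , refl

-- The word of a chord diagram

abstract
  -- The points are listed from left to right. Starting at the largest `v` suffices, because every
  -- `p c` and every emitted minimum is smaller. Later arguments use only the membership and the
  -- order established in this block.
  word : List Chord → List Point
  word E = concatMap (at E) (downFrom (suc (max 0 (map v E))))

  private
    v≤M : ∀ E {c} → c ∈ E → v c ≤ max 0 (map v E)
    v≤M E c∈ = All.lookup (xs≤max 0 (map v E)) (∈-map⁺ v c∈)

  at⁻ : ∀ E → ∀ {e z} → z ∈ at E e → (z ≡ inj₁ e × Emits E e) ⊎ (∃[ c ] z ≡ inj₂ c × c ∈ E × p c ≡ e)
  at⁻ E {e} z∈ with ∈-++⁻ (map inj₁ (filter (emits? E) (e ∷ []))) z∈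
  ... | inj₁ q with _ , here refl , refl , em ← ∈-map∘filter⁻ inj₁ (emits? E) {xs = e ∷ []} q = inj₁ (refl , em)
  ... | inj₂ q with c , c∈ , refl , eq ← ∈-map∘filter⁻ inj₂ (λ c → p c ≟ e) {xs = E} q = inj₂ (c , refl , c∈ , eq)

  word⁻ : ∀ E → ∀ {z} → z ∈ word E → (∃[ e ] z ≡ inj₁ e × Emits E e) ⊎ (∃[ c ] z ≡ inj₂ c × c ∈ E)
  word⁻ E z∈ with e , _ , q ← find (∈-concatMap⁻ (at E) {xs = downFrom (suc (max 0 (map v E)))} z∈) with at⁻ E q
  ... | inj₁ (eq , em) = inj₁ (e , eq , em)
  ... | inj₂ (c , eq , c∈ , _) = inj₂ (c , eq , c∈)

  chord∈word : ∀ E → Valid E → ∀ {c} → c ∈ E → inj₂ c ∈ word E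
  chord∈word E valid {c} c∈ = ∈-concatMap⁺ (at E) (lose (∈-downFrom⁺ (s≤s (<⇒≤ (<-≤-trans (Valid.p<v valid c∈) (v≤M E c∈)))))
    (∈-++⁺ʳ _ (∈-map∘filter⁺ inj₂ (λ d → p d ≟ p c) (c , c∈ , refl , refl))))

  emits∈word : ∀ E → ∀ {e} → Emits E e → inj₁ e ∈ word E
  emits∈word E {e} em@(_ , above) with c , c∈ , e<v ← find above =
    ∈-concatMap⁺ (at E) (lose (∈-downFrom⁺ (s≤s (<⇒≤ (<-≤-trans e<v (v≤M E c∈)))))
      (∈-++⁺ˡ (∈-map∘filter⁺ inj₁ (emits? E) (e , here refl , refl , em))))

  word-descending : ∀ E → Valid E → Descending posn (word E)
  word-descending E valid = AllPairs.concat⁺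
    (All.map⁺ (All.universal (λ e → AllPairs.++⁺
        (AllPairs.map⁺ (AllPairs.filter⁺ (emits? E) ([] ∷ [])))
        (AllPairs.map⁺ (AllPairs.map (*-monoʳ-< 2) (AllPairs.filter⁺ (λ c → p c ≟ e) (Valid.descending valid))))
        (All.map⁺ (All.tabulate λ q → All.map⁺ (All.tabulate λ r → inside (∈-filter⁻ (emits? E) q) (∈-filter⁻ (λ c → p c ≟ e) r)))))
      (downFrom (suc (max 0 (map v E))))))
    (AllPairs.map⁺ (AllPairs.map (λ lt → All.tabulate λ q → All.tabulate λ r → across lt (at⁻ E q) (at⁻ E r))
      (AllPairs.applyDownFrom⁺₁ id (suc (max 0 (map v E))) λ j<i _ → j<i)))
    where
    inside : ∀ {e x c} → x ∈ e ∷ [] × Emits E x → c ∈ E × p c ≡ e → 2 * p c < suc (2 * x)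
    inside (here refl , _) (_ , refl) = n<1+n _
    across : ∀ {e f x y} → e < f → (x ≡ inj₁ f × Emits E f) ⊎ (∃[ c ] x ≡ inj₂ c × c ∈ E × p c ≡ f) →
             (y ≡ inj₁ e × Emits E e) ⊎ (∃[ c ] y ≡ inj₂ c × c ∈ E × p c ≡ e) → posn y < posn x
    across lt (inj₁ (refl , _)) (inj₁ (refl , _)) = <⇒odd<odd lt
    across lt (inj₁ (refl , _)) (inj₂ (_ , refl , _ , refl)) = ≤⇒even<odd (<⇒≤ lt)
    across lt (inj₂ (_ , refl , _ , refl)) (inj₁ (refl , _)) = <⇒odd<even lt
    across lt (inj₂ (_ , refl , _ , refl)) (inj₂ (_ , refl , _ , refl)) = *-monoʳ-< 2 lt

module _ (E : List Chord) where

  val-injective : Valid E → ∀ {x y} → x ∈ word E → y ∈ word E → val x ≡ val y → x ≡ y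
  val-injective valid x∈ y∈ eq with word⁻ E x∈ | word⁻ E y∈
  ... | inj₁ (e , refl , _) | inj₁ (f , refl , _) = cong inj₁ (*-cancelˡ-≡ e f 2 (suc-injective eq))
  ... | inj₁ (e , refl , _) | inj₂ (c , refl , _) = contradiction (sym eq) (even≢odd (v c) e)
  ... | inj₂ (c , refl , _) | inj₁ (e , refl , _) = contradiction eq (even≢odd (v c) e)
  ... | inj₂ (c , refl , c∈) | inj₂ (d , refl , d∈) =
    cong inj₂ (Valid.v-inj valid c∈ d∈ (*-cancelˡ-≡ (v c) (v d) 2 eq))

  word-unique : Valid E → Unique (map val (word E))
  word-unique valid = descending⇒unique posn val (word-descending E valid) (val-injective valid)

  chords⊆word : Valid E → ∀ {s} → s ⊆ E → map (2 *_) (map v s) ⊆ map val (word E)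
  chords⊆word valid {s} s⊆E = subst (_⊆ map val (word E))
    (trans (sym (map-∘ s)) (map-∘ s))
    (Sub.map⁺ val (descending-⊆ posn
      (AllPairs.map⁺ (AllPairs.map (*-monoʳ-< 2) (AllPairs-⊆ s⊆E (Valid.descending valid))))
      (word-descending E valid) in-word))
    where
    in-word : ∀ {z} → z ∈ map inj₂ s → z ∈ word E
    in-word z∈ with c , c∈ , refl ← ∈-map⁻ inj₂ z∈ = chord∈word E valid (Sub.lookup s⊆E c∈)

  -- A minimum has no point to its lower left, so in a copy of 1 ⊕ ρ all entries after the first are
  -- chords. The first entry lies to their lower left and so provides a gap spanned by all of them:
  -- they form a clique whose values are a copy of ρ.
  word-avoids : ∀ {ρ} → Valid E → Good ρ E → ¬ (oneSum ρ ≼ st (map val (word E)))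
  word-avoids {ρ} valid good occ
    with s , s⊆ , eq ← ≼-st⁻ {w = map val (word E)} occ
    with m , s' , refl , m< , eq' ← st-oneSum⁻ (AllPairs-⊆ s⊆ (word-unique valid)) eq
    with z ∷ zs , zs⊆ , refl ← ⊆-map⁻ val s⊆ = conclude (AllPairs-⊆ zs⊆ (word-descending E valid))
    where
    conclude : Descending posn (z ∷ zs) → ⊥
    conclude (z> ∷ d) = clash (all-chords zs λ a∈ → is-chord (All.lookup z> a∈) (m< (∈-map⁺ val a∈))
        (word⁻ E (Sub.lookup zs⊆ (here refl))) (word⁻ E (Sub.lookup zs⊆ (there a∈))))
      where
      is-chord : ∀ {a} → posn a < posn z → val z < val a →
                 (∃[ e ] z ≡ inj₁ e × Emits E e) ⊎ (∃[ c ] z ≡ inj₂ c × c ∈ E) →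
                 (∃[ e ] a ≡ inj₁ e × Emits E e) ⊎ (∃[ c ] a ≡ inj₂ c × c ∈ E) → ∃[ c ] a ≡ inj₂ c
      is-chord _ _ _ (inj₂ (c , eq , _)) = c , eq
      is-chord lt lt' (inj₁ (_ , refl , _)) (inj₁ (_ , refl , _)) = contradiction lt' (<-asym lt)
      -- Here v c ≤ e < p c, against `p c < v c`.
      is-chord lt lt' (inj₂ (c , refl , c∈)) (inj₁ (e , refl , _)) =
        contradiction (<-trans (odd<even⇒< {e} {p c} lt) (Valid.p<v valid c∈)) (≤⇒≯ (even<odd⇒≤ {v c} {e} lt'))
      clash : ∃[ cs ] zs ≡ map inj₂ cs → ⊥
      clash (cs , refl) = good
        (descending-⊆ p (AllPairs.map even<even⇒< (AllPairs.map⁻ d)) (Valid.descending valid) ∈E)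
        clique
        (trans (sym (st-double (map v cs))) (trans (cong st (trans (sym (map-∘ cs)) (map-∘ cs))) eq'))
        where
        ∈E : ∀ {c} → c ∈ cs → c ∈ E
        ∈E c∈ with word⁻ E (Sub.lookup zs⊆ (there (∈-map⁺ inj₂ c∈)))
        ... | inj₂ (_ , refl , q) = q
        clique : Clique cs
        clique {a} {b} a∈ b∈ with word⁻ E (Sub.lookup zs⊆ (here refl))
        ... | inj₁ (e , refl , _) = ≤-<-trans (even<odd⇒≤ {p a} {e} (All.lookup z> (∈-map⁺ inj₂ a∈)))
                (odd<even⇒< {e} {v b} (m< (∈-map⁺ val (∈-map⁺ inj₂ b∈))))
        ... | inj₂ (c , refl , c∈) = <-trans (even<even⇒< {p a} {p c} (All.lookup z> (∈-map⁺ inj₂ a∈)))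
                (<-trans (Valid.p<v valid c∈) (even<even⇒< {v c} {v b} (m< (∈-map⁺ val (∈-map⁺ inj₂ b∈)))))

-- Simplicity of the word of a chained diagram

-- By induction on the list: a crossing joins the head to the tail, and `J` passes through it in
-- both directions.
chained-spread : ∀ (J : Chord → Set) {E} → Chained E →
  (∀ {a b} → a ∈ E → b ∈ E → Crosses a b → J a ⇔ J b) →
  ∀ {c} → c ∈ E → J c → ∀ {d} → d ∈ E → J d
chained-spread J (inj₁ refl , _) h (here refl) Jc (here refl) = Jc
chained-spread J (inj₁ refl , _) h (there ())
chained-spread J {a ∷ E} (inj₂ link , chain) h c∈ Jc with b , b∈ , cr ← find link = all
  where
  rest : ∀ {c} → c ∈ E → J c → ∀ {d} → d ∈ E → J d
  rest = chained-spread J chain (λ a∈ b∈ → h (there a∈) (there b∈))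
  tail : ∀ {c} → c ∈ a ∷ E → J c → ∀ {d} → d ∈ E → J d
  tail (here refl) Jc = rest b∈ (Equivalence.to (h (here refl) (there b∈) cr) Jc)
  tail (there q) Jc = rest q Jc
  all : ∀ {d} → d ∈ a ∷ E → J d
  all (there d∈) = tail c∈ Jc d∈
  all (here refl) = Equivalence.from (h (here refl) (there b∈) cr) (tail c∈ Jc b∈)

module _ {E : List Chord} (valid : Valid E) (chained : Chained E) where
  open Valid valid

  Between : (Point → ℕ) → (Point → Set) → Set
  Between f I = ∀ {x y z} → I x → I y → z ∈ word E → f x < f z → f z < f y → I z

  module _ (I : Point → Set) (I⊆ : ∀ {z} → I z → z ∈ word E)
           (by-posn : Between posn I) (by-val : Between val I) where

    minimum∈word : ∀ {c} → c ∈ E → inj₁ (p c) ∈ word E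
    minimum∈word c∈ = emits∈word E (lose c∈ (inj₁ refl) , lose c∈ (p<v c∈))

    -- The minimum at `p c` stands immediately to the left of `c` and below it. Seen from the
    -- minimum at `e`, it is enclosed in value if e < p c and in position if p c < e.
    own-minimum : ∀ {e c} → I (inj₁ e) → c ∈ E → I (inj₂ c) → I (inj₁ (p c))
    own-minimum {e} {c} Ie c∈ Ic with <-cmp e (p c)
    ... | tri< e<p _ _ = by-val Ie Ic (minimum∈word c∈) (<⇒odd<odd e<p) (<⇒odd<even (p<v c∈))
    ... | tri≈ _ refl _ = Ie
    ... | tri> _ _ p<e = by-posn Ic Ie (minimum∈word c∈) (n<1+n _) (<⇒odd<odd p<e)

    spread : ∀ {e c} → I (inj₁ e) → c ∈ E → I (inj₂ c) → ∀ {z} → z ∈ word E → I z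
    spread {c = c₀} I₀ c₀∈ Ic₀ = reach
      where
      crossing : ∀ {a b} → a ∈ E → b ∈ E → Crosses a b → I (inj₂ a) ⇔ I (inj₂ b)
      crossing {a} {b} a∈ b∈ (pb<pa , pa<vb , vb<va) = mk⇔
        (λ Ia → by-val (own-minimum I₀ a∈ Ia) Ia (chord∈word E valid b∈) (<⇒odd<even pa<vb) (*-monoʳ-< 2 vb<va))
        -- The minimum at `p a` lies in value between the minimum at `p b` and `b`; then `a` lies in
        -- position between these two minima.
        (λ Ib → by-posn (own-minimum I₀ b∈ Ib)
          (by-val (own-minimum I₀ b∈ Ib) Ib (minimum∈word a∈) (<⇒odd<odd pb<pa) (<⇒odd<even pa<vb))
          (chord∈word E valid a∈) (<⇒odd<even pb<pa) (n<1+n _))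
      chords : ∀ {d} → d ∈ E → I (inj₂ d)
      chords = chained-spread (I ∘ inj₂) chained crossing c₀∈ Ic₀
      minima : ∀ {e} → Emits E e → I (inj₁ e)
      minima em@(end , above) with find end
      ... | c , c∈ , inj₁ refl = own-minimum I₀ c∈ (chords c∈)
      -- The minimum above `v c` lies in value between the minimum at `p c` and a chord `d` ending
      -- higher.
      ... | c , c∈ , inj₂ refl with d , d∈ , v<v ← find above =
        by-val (own-minimum I₀ c∈ (chords c∈)) (chords d∈) (emits∈word E em) (<⇒odd<odd (p<v c∈)) (<⇒odd<even v<v)
      reach : ∀ {z} → z ∈ word E → I z
      reach z∈ with word⁻ E z∈
      ... | inj₁ (_ , refl , em) = minima em
      ... | inj₂ (_ , refl , d∈) = chords d∈

    -- By `spread` one minimum and one chord in `I` suffice. Two chords enclose in position the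
    -- minimum just before the right one. Two minima enclose, in position or in value, the chord
    -- whose endpoint accounts for the left one.
    whole : ∀ {x y} → I x → I y → posn x < posn y → ∀ {z} → z ∈ word E → I z
    whole Ix Iy lt with word⁻ E (I⊆ Ix) | word⁻ E (I⊆ Iy)
    ... | inj₁ (e , refl , _) | inj₂ (c , refl , c∈) = spread Ix c∈ Iy
    ... | inj₂ (c , refl , c∈) | inj₁ (e , refl , _) = spread Iy c∈ Ix
    ... | inj₂ (c , refl , c∈) | inj₂ (d , refl , d∈) =
      spread (by-posn Ix Iy (minimum∈word c∈) (n<1+n _) (<⇒odd<even (even<even⇒< {p c} {p d} lt))) c∈ Ix
    ... | inj₁ (e , refl , _) | inj₁ (f , refl , end , _) with find end
    ...   | c , c∈ , inj₁ refl = spread Ix c∈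
      (by-posn Ix Iy (chord∈word E valid c∈) (<⇒odd<even (odd<odd⇒< {e} {f} lt)) (n<1+n _))
    ...   | c , c∈ , inj₂ refl = spread Ix c∈
      (by-val Ix Iy (chord∈word E valid c∈) (<⇒odd<even (odd<odd⇒< {e} {f} lt)) (n<1+n _))

  word-simple : ∀ {c} → c ∈ E → IsSimple (st (map val (word E)))
  word-simple c∈ = st-IsSimple (word-unique E valid) nonempty segment
    where
    nonempty : 1 ≤ length (map val (word E))
    nonempty = ∈-length (∈-map⁺ val (chord∈word E valid c∈))
    segment : ∀ X u Y → map val (word E) ≡ X ++ u ++ Y → Convex u (map val (word E)) →
              2 ≤ length u → length (map val (word E)) ≤ length u
    segment X u Y eq convex two
      with X' , R , eqW , refl , eqR ← map≡++ val (word E) X eq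
      with u' , Y' , refl , refl , refl ← map≡++ val R u eqR =
      subst₂ _≤_ (sym (length-map val (word E))) (sym (length-map val u'))
        -- Once every point of the word is in the factor, the word is a sublist of it, since both
        -- are sorted by `posn`.
        (Sub.length-mono-≤ (descending-⊆ posn desc (AllPairs-⊆ u'⊆ desc) (all (AllPairs-⊆ u'⊆ desc) two)))
      where
      desc = word-descending E valid
      u'⊆ : u' ⊆ word E
      u'⊆ = subst (u' ⊆_) (sym eqW) (Sub.++⁺ˡ X' (Sub.++⁺ʳ Y' Sub.⊆-refl))
      desc' : Descending posn (X' ++ u' ++ Y')
      desc' = subst (Descending posn) eqW desc
      by-posn : Between posn (_∈ u')
      by-posn x∈ y∈ z∈ x<z z<y with ∈-++⁻ X' (subst (_ ∈_) eqW z∈)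
      ... | inj₁ q = contradiction (AllPairs-across X' desc' q (∈-++⁺ˡ y∈)) (<-asym z<y)
      ... | inj₂ q with ∈-++⁻ u' q
      ...   | inj₁ z∈u = z∈u
      ...   | inj₂ z∈Y = contradiction
        (AllPairs-across u' (AllPairs-⊆ (Sub.++⁺ˡ X' Sub.⊆-refl) desc') x∈ z∈Y) (<-asym x<z)
      by-val : Between val (_∈ u')
      by-val x∈ y∈ z∈ x<z z<y
        with z' , z'∈ , eq' ← ∈-map⁻ val (convex (∈-map⁺ val x∈) (∈-map⁺ val y∈) (∈-map⁺ val z∈) x<z z<y)
        = subst (_∈ u') (sym (val-injective E valid z∈ (Sub.lookup u'⊆ z'∈) eq')) z'∈
      all : Descending posn u' → 2 ≤ length (map val u') → ∀ {z} → z ∈ word E → z ∈ u'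
      all ((b<a ∷ _) ∷ _) _ = whole (_∈ u') (Sub.lookup u'⊆) by-posn by-val (there (here refl)) (here refl) b<a
      all ([] ∷ []) (s≤s ())

-- Inserting a chord without creating a copy of ρ

⊆-++⁻ : ∀ (xs : List A) {s ys} → s ⊆ xs ++ ys → ∃[ s₁ ] ∃[ s₂ ] s ≡ s₁ ++ s₂ × s₁ ⊆ xs × s₂ ⊆ ys
⊆-++⁻ [] τ = [] , _ , refl , [] , τ
⊆-++⁻ (x ∷ xs) (_ ∷ʳ τ) with s₁ , s₂ , eq , σ₁ , σ₂ ← ⊆-++⁻ xs τ = s₁ , s₂ , eq , x ∷ʳ σ₁ , σ₂
⊆-++⁻ (x ∷ xs) (refl ∷ τ) with s₁ , s₂ , eq , σ₁ , σ₂ ← ⊆-++⁻ xs τ = x ∷ s₁ , s₂ , cong (x ∷_) eq , refl ∷ σ₁ , σ₂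

below≤1 : ∀ {x y} xs → Unique xs → (∀ {a} → a ∈ xs → a < x → a ≡ y) → below x xs ≤ 1
below≤1 [] _ _ = z≤n
below≤1 {x} (a ∷ xs) (a∉ ∷ u) only with a <? x
... | no a≮x = subst (_≤ 1) (sym (below-reject xs a≮x)) (below≤1 xs u (only ∘ there))
... | yes a<x = ≤-reflexive (trans (below-accept xs a<x) (cong suc (below-none xs λ b∈ b<x →
        All.lookup a∉ b∈ (trans (only (here refl) a<x) (sym (only (there b∈) b<x))))))

singleton-avoids : ∀ {ρ x s} → StartsWithDescent ρ → s ⊆ x ∷ [] → st s ≢ oneSum ρ
singleton-avoids _ (_ ∷ʳ []) ()
singleton-avoids {ρ = []} () (refl ∷ [])
singleton-avoids {ρ = _ ∷ _} _ (refl ∷ []) eq with () ← ∷-injectiveʳ eq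

-- If a single entry were smaller than the first, it would be the second, and the two would form a
-- decreasing bond. In terms of ρ this is ρ(1) ≥ 3.
large-head : ∀ {ρ s} → StartsWithDescent ρ → NoDecreasingBond ρ → st s ≡ ρ →
             ∃[ x ] ∃[ t ] s ≡ x ∷ t × 2 ≤ below x s
large-head {s = []} () _ refl
large-head {s = x ∷ []} () _ refl
large-head {s = x ∷ y ∷ s} lt (≢suc , _) refl =
  x , _ , refl , s≤s⁻¹ (≤∧≢⇒< (≤-trans (s≤s (s≤s z≤n)) lt) λ eq → ≢suc
    (trans (sym eq) (cong suc (≤-antisym (s≤s z≤n) (s≤s⁻¹ (subst (rank y (x ∷ y ∷ s) <_) (sym eq) lt))))))

values-unique : ∀ {E s} → Valid E → s ⊆ E → Unique (map v s)
values-unique valid s⊆E = descending⇒unique p v (AllPairs-⊆ s⊆E (Valid.descending valid))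
  (λ a∈ b∈ → Valid.v-inj valid (Sub.lookup s⊆E a∈) (Sub.lookup s⊆E b∈))

SameSide : ℕ → ℕ → ℕ → Set
SameSide x y a = (a < x × a < y) ⊎ (x < a × y < a)

SameSide⇒⇔ : ∀ {x y a} → SameSide x y a → (a < x ⇔ a < y) × (x < a ⇔ y < a)
SameSide⇒⇔ (inj₁ (l , m)) = mk⇔ (λ _ → m) (λ _ → l) , mk⇔ (⊥-elim ∘ <-asym l) (⊥-elim ∘ <-asym m)
SameSide⇒⇔ (inj₂ (l , m)) = mk⇔ (⊥-elim ∘ <-asym l) (⊥-elim ∘ <-asym m) , mk⇔ (λ _ → m) (λ _ → l)

descending-insert-after : ∀ (f : A → ℕ) xs {b c ys} → Descending f (xs ++ c ∷ ys) →
  f b < f c → (∀ {a} → a ∈ ys → f a < f b) → Descending f (xs ++ c ∷ b ∷ ys)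
descending-insert-after f [] (_ ∷ d) b<c <b =
  (b<c ∷ All.tabulate (λ q → <-trans (<b q) b<c)) ∷ All.tabulate <b ∷ d
descending-insert-after f (x ∷ xs) (h ∷ d) b<c <b with hx , hc ∷ hy ← All.++⁻ xs h =
  All.++⁺ hx (hc ∷ <-trans b<c hc ∷ hy) ∷ descending-insert-after f xs d b<c <b

descending-insert-before : ∀ (f : A → ℕ) xs {b c ys} → Descending f (xs ++ c ∷ ys) →
  f c < f b → (∀ {a} → a ∈ xs → f b < f a) → Descending f (xs ++ b ∷ c ∷ ys)
descending-insert-before f [] (h ∷ d) c<b b< =
  (c<b ∷ All.map (λ lt → <-trans lt c<b) h) ∷ h ∷ d
descending-insert-before f (x ∷ xs) (h ∷ d) c<b b< with hx , hc ∷ hy ← All.++⁻ xs h =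
  All.++⁺ hx (b< (here refl) ∷ hc ∷ hy) ∷ descending-insert-before f xs d c<b (b< ∘ there)

valid-insert : ∀ {E E' b} → Valid E → Descending p E' → (∀ {a} → a ∈ E' → a ∈ E ⊎ a ≡ b) →
  p b < v b → (∀ {a} → a ∈ E → p a ≢ v b × p b ≢ v a × v a ≢ v b) → Valid E'
valid-insert {E} {E'} {b} valid desc split pb<vb fresh = record
  { descending = desc
  ; p<v = λ a∈ → p<v' (split a∈)
  ; p≢v = λ a∈ b∈ → p≢v' (split a∈) (split b∈)
  ; v-inj = λ a∈ b∈ → v-inj' (split a∈) (split b∈)
  }
  where
  open Valid valid
  p<v' : ∀ {a} → a ∈ E ⊎ a ≡ b → p a < v a
  p<v' (inj₁ a∈) = p<v a∈
  p<v' (inj₂ refl) = pb<vb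
  p≢v' : ∀ {a c} → a ∈ E ⊎ a ≡ b → c ∈ E ⊎ c ≡ b → p a ≢ v c
  p≢v' (inj₁ a∈) (inj₁ c∈) = p≢v a∈ c∈
  p≢v' (inj₁ a∈) (inj₂ refl) = proj₁ (fresh a∈)
  p≢v' (inj₂ refl) (inj₁ c∈) = proj₁ (proj₂ (fresh c∈))
  p≢v' (inj₂ refl) (inj₂ refl) = <⇒≢ pb<vb
  v-inj' : ∀ {a c} → a ∈ E ⊎ a ≡ b → c ∈ E ⊎ c ≡ b → v a ≡ v c → a ≡ c
  v-inj' (inj₁ a∈) (inj₁ c∈) eq = v-inj a∈ c∈ eq
  v-inj' (inj₁ a∈) (inj₂ refl) eq = contradiction eq (proj₂ (proj₂ (fresh a∈)))
  v-inj' (inj₂ refl) (inj₁ c∈) eq = contradiction (sym eq) (proj₂ (proj₂ (fresh c∈)))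
  v-inj' (inj₂ refl) (inj₂ refl) eq = refl

module _ {ρ : List ℕ} (descent : StartsWithDescent ρ) (bondless : NoDecreasingBond ρ) where

  -- A copy of ρ through b cannot meet d, whose value would be at most the second smallest;
  -- hence b can be replaced by c, or forms a decreasing bond with it.
  good-insert : ∀ {P d A B b c h l} →
    (h ≡ c × l ≡ b) ⊎ (h ≡ b × l ≡ c) → v l < v h →
    Good ρ ((P ++ d ∷ A) ++ c ∷ B) → Valid ((P ++ d ∷ A) ++ h ∷ l ∷ B) →
    (∀ {a} → a ∈ P → v b < p a) →
    (∀ {a} → a ∈ A ++ c ∷ B → p d < v a → v d < v a) →
    (∀ {a} → a ∈ A ⊎ a ∈ B → SameSide (v b) (v c) (v a)) →
    (∀ {a} → a ∈ A ⊎ a ∈ B → p b < v a → p a < v b → p c < v a × p a < v c) →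
    p c < v c →
    Good ρ ((P ++ d ∷ A) ++ h ∷ l ∷ B)
  good-insert {P} {d} {A} {B} {b} {c} {h} {l} hl vl<vh good valid beyond unlinked same-side compat pc<vc {s} s⊆ clique eq
    with s₁ , s₂ , refl , s₁⊆ , s₂⊆ ← ⊆-++⁻ (P ++ d ∷ A) s⊆ = cases s₂⊆ refl
    where
    b-or-c : (h ≡ c × l ≡ b) ⊎ (h ≡ b × l ≡ c) → ∀ {a} → a ∈ h ∷ l ∷ B → a ≡ b ⊎ a ∈ c ∷ B
    b-or-c (inj₁ (refl , _)) (here refl) = inj₂ (here refl)
    b-or-c (inj₁ (_ , refl)) (there (here refl)) = inj₁ refl
    b-or-c (inj₂ (refl , _)) (here refl) = inj₁ refl
    b-or-c (inj₂ (_ , refl)) (there (here refl)) = inj₂ (here refl)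
    b-or-c _ (there (there q)) = inj₂ (there q)

    avoids-d : b ∈ s₁ ++ s₂ → s₁ ⊆ A
    avoids-d b∈ with ⊆-++⁻ P s₁⊆
    -- Chords of `P` start beyond `v b`, so none is in a clique with `b`.
    ... | x ∷ _ , _ , refl , τ , _ = contradiction (clique (here refl) b∈) (<-asym (beyond (Sub.lookup τ (here refl))))
    ... | [] , _ , refl , _ , _ ∷ʳ τ = τ
    -- Now `d` comes first in the copy. Any later chord in a clique with `d`, other than `b`, ends
    -- above `d`, so only `b` can be smaller.
    ... | [] , _ ∷ t , refl , _ , refl ∷ τ with large-head descent bondless eq
    ...   | _ , _ , refl , two = contradiction two (<⇒≱ (s≤s
        (below≤1 {y = v b} (map v ((d ∷ t) ++ s₂)) (values-unique valid s⊆) only)))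
      where
      only : ∀ {a} → a ∈ map v ((d ∷ t) ++ s₂) → a < v d → a ≡ v b
      only q lt with ∈-map⁻ v {xs = (d ∷ t) ++ s₂} q
      ... | _ , here refl , refl = contradiction lt (<-irrefl refl)
      ... | a , there q' , refl with ∈-++⁻ t q'
      ...   | inj₁ a∈t = contradiction (unlinked (∈-++⁺ˡ (Sub.lookup τ a∈t)) (clique (here refl) (there q'))) (<-asym lt)
      ...   | inj₂ a∈s₂ with b-or-c hl (Sub.lookup s₂⊆ a∈s₂)
      ...     | inj₁ refl = refl
      ...     | inj₂ a∈ = contradiction (unlinked (∈-++⁺ʳ A a∈) (clique (here refl) (there q'))) (<-asym lt)

    side : ∀ {t} → s₁ ⊆ A → t ⊆ B → ∀ {y} → y ∈ map v s₁ ⊎ y ∈ map v t → SameSide (v b) (v c) y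
    side σ τ (inj₁ q) with a , a∈ , refl ← ∈-map⁻ v q = same-side (inj₁ (Sub.lookup σ a∈))
    side σ τ (inj₂ q) with a , a∈ , refl ← ∈-map⁻ v q = same-side (inj₂ (Sub.lookup τ a∈))

    only-one : ∀ {x t} → x ≡ c ⊎ x ≡ b → s₂ ≡ x ∷ t → t ⊆ B → ⊥
    only-one (inj₁ refl) refl τ = good (Sub.++⁺ s₁⊆ (refl ∷ τ)) clique eq
    only-one {t = t} (inj₂ refl) refl τ = good (Sub.++⁺ s₁⊆ (refl ∷ τ)) clique' (begin
      st (map v (s₁ ++ c ∷ t))        ≡⟨ cong st (map-++ v s₁ (c ∷ t)) ⟩
      st (map v s₁ ++ v c ∷ map v t)  ≡⟨ st-replace (map v s₁) (map v t) (SameSide⇒⇔ ∘ side σ τ) ⟨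
      st (map v s₁ ++ v b ∷ map v t)  ≡⟨ cong st (map-++ v s₁ (b ∷ t)) ⟨
      st (map v (s₁ ++ b ∷ t))        ≡⟨ eq ⟩
      ρ                               ∎)
      where
      open ≡-Reasoning
      b∈ : b ∈ s₁ ++ b ∷ t
      b∈ = ∈-++⁺ʳ s₁ (here refl)
      σ = avoids-d b∈
      old : ∀ {a} → a ∈ s₁ ++ c ∷ t → a ≡ c ⊎ (a ∈ s₁ ++ b ∷ t × (a ∈ A ⊎ a ∈ B))
      old q with ∈-++⁻ s₁ q
      ... | inj₁ q' = inj₂ (∈-++⁺ˡ q' , inj₁ (Sub.lookup σ q'))
      ... | inj₂ (here refl) = inj₁ refl
      ... | inj₂ (there q') = inj₂ (∈-++⁺ʳ s₁ (there q') , inj₂ (Sub.lookup τ q'))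
      both : ∀ {a} → a ∈ s₁ ++ b ∷ t → a ∈ A ⊎ a ∈ B → p c < v a × p a < v c
      both q ab = compat ab (clique b∈ q) (clique q b∈)
      clique' : Clique (s₁ ++ c ∷ t)
      clique' q r with old q | old r
      ... | inj₁ refl | inj₁ refl = pc<vc
      ... | inj₁ refl | inj₂ (r' , ab) = proj₁ (both r' ab)
      ... | inj₂ (q' , ab) | inj₁ refl = proj₂ (both q' ab)
      ... | inj₂ (q' , _) | inj₂ (r' , _) = clique q' r'

    two-sides : (h ≡ c × l ≡ b) ⊎ (h ≡ b × l ≡ c) → ∀ {y} → SameSide (v b) (v c) y → y < v h → y < v l
    two-sides (inj₁ (refl , refl)) ss = Equivalence.from (proj₁ (SameSide⇒⇔ ss))
    two-sides (inj₂ (refl , refl)) ss = Equivalence.to (proj₁ (SameSide⇒⇔ ss))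

    b∈hl : (h ≡ c × l ≡ b) ⊎ (h ≡ b × l ≡ c) → ∀ t → b ∈ h ∷ l ∷ t
    b∈hl (inj₁ (_ , refl)) t = there (here refl)
    b∈hl (inj₂ (refl , _)) t = here refl

    cases : ∀ {t} → t ⊆ h ∷ l ∷ B → t ≡ s₂ → ⊥
    cases (_ ∷ʳ _ ∷ʳ τ) refl = good (Sub.++⁺ s₁⊆ (c ∷ʳ τ)) clique eq
    cases (refl ∷ _ ∷ʳ τ) refl = only-one ([ inj₁ ∘ proj₁ , inj₂ ∘ proj₁ ] hl) refl τ
    cases (_ ∷ʳ refl ∷ τ) refl = only-one ([ inj₂ ∘ proj₂ , inj₁ ∘ proj₂ ] hl) refl τ
    -- The copy has `h` and `l` in adjacent positions, and every other value of it lies on the same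
    -- side of both.
    cases {_ ∷ _ ∷ t} (refl ∷ refl ∷ τ) refl = bond-free (map v s₁) (map v t)
      (subst NoDecreasingBond (trans (sym eq) (cong st (map-++ v s₁ (h ∷ l ∷ t)))) bondless) vl<vh
      (two-sides hl ∘ side (avoids-d (∈-++⁺ʳ s₁ (b∈hl hl t))) τ)

-- Linking chords

chained-++⁻ʳ : ∀ xs {ys} → Chained (xs ++ ys) → Chained ys
chained-++⁻ʳ [] ch = ch
chained-++⁻ʳ (_ ∷ xs) (_ , ch) = chained-++⁻ʳ xs ch

⊆-insert-after : ∀ (xs : List A) {b c ys} → xs ++ c ∷ ys ⊆ xs ++ c ∷ b ∷ ys
⊆-insert-after xs = Sub.++⁺ (Sub.⊆-refl {x = xs}) (refl ∷ _ ∷ʳ Sub.⊆-refl)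

⊆-insert-before : ∀ (xs : List A) {b c ys} → xs ++ c ∷ ys ⊆ xs ++ b ∷ c ∷ ys
⊆-insert-before xs = Sub.++⁺ (Sub.⊆-refl {x = xs}) (_ ∷ʳ Sub.⊆-refl)

chained-insert-after : ∀ xs {b c ys} → Chained (xs ++ c ∷ ys) → Crosses c b →
  (ys ≡ [] ⊎ Any (Crosses b) ys) → Chained (xs ++ c ∷ b ∷ ys)
chained-insert-after [] (_ , ch) cb link = inj₂ (here cb) , link , ch
chained-insert-after (x ∷ []) (inj₁ () , _) cb link
chained-insert-after (x ∷ _ ∷ xs) (inj₁ () , _) cb link
chained-insert-after (x ∷ xs) (inj₂ l , ch) cb link =
  inj₂ (Sub.Any-resp-⊆ (⊆-insert-after xs) l) , chained-insert-after xs ch cb link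

chained-insert-before : ∀ xs {b c ys} → Chained (xs ++ c ∷ ys) → Crosses b c → Chained (xs ++ b ∷ c ∷ ys)
chained-insert-before [] ch bc = inj₂ (here bc) , ch
chained-insert-before (x ∷ []) (inj₁ () , _) bc
chained-insert-before (x ∷ _ ∷ xs) (inj₁ () , _) bc
chained-insert-before (x ∷ xs) (inj₂ l , ch) bc =
  inj₂ (Sub.Any-resp-⊆ (⊆-insert-before xs) l) , chained-insert-before xs ch bc

Endpoint : List Chord → ℕ → Set
Endpoint E e = ∃[ a ] a ∈ E × (e ≡ p a ⊎ e ≡ v a)

-- There is room for new endpoints next to every endpoint.
record Wide (E : List Chord) : Set where
  field
    gap : ∀ {e f} → Endpoint E e → Endpoint E f → e < f → suc (suc e) < f
    p-pos : ∀ {a} → a ∈ E → ∃[ m ] p a ≡ suc m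

argmin-∈ : ∀ {Q : A → Set} (Q? : ∀ a → Dec (Q a)) (f : A → ℕ) xs → Any Q xs →
           ∃[ c ] c ∈ xs × Q c × (∀ {a} → a ∈ xs → Q a → f c ≤ f a)
argmin-∈ {Q = Q} Q? f xs any with find any
... | c₀ , c₀∈ , Qc₀ = c , proj₁ c∈ , proj₂ c∈ , λ a∈ Qa →
  All.lookup (f[argmin]≤f[xs] {f = f} c₀ (filter Q? xs)) (∈-filter⁺ Q? a∈ Qa)
  where
  c = argmin f c₀ (filter Q? xs)
  c∈ : c ∈ xs × Q c
  c∈ with argmin-sel f c₀ (filter Q? xs)
  ... | inj₁ eq = subst (λ z → z ∈ xs × Q z) (sym eq) (c₀∈ , Qc₀)
  ... | inj₂ q = ∈-filter⁻ Q? q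

argmax-∈ : ∀ (f : A → ℕ) xs → xs ≢ [] → ∃[ c ] c ∈ xs × (∀ {a} → a ∈ xs → f a ≤ f c)
argmax-∈ f [] ne = contradiction refl ne
argmax-∈ f (x ∷ xs) _ = argmax f x xs , c∈ , ub
  where
  c∈ : argmax f x xs ∈ x ∷ xs
  c∈ with argmax-sel f x xs
  ... | inj₁ eq = here eq
  ... | inj₂ q = there q
  ub : ∀ {a} → a ∈ x ∷ xs → f a ≤ f (argmax f x xs)
  ub (here refl) = f[⊥]≤f[argmax] {f = f} x xs
  ub (there q) = All.lookup (f[xs]≤f[argmax] {f = f} x xs) q

∈-insert⁻ : ∀ (xs : List A) {h l b c ys} → (h ≡ c × l ≡ b) ⊎ (h ≡ b × l ≡ c) →
            ∀ {a} → a ∈ xs ++ h ∷ l ∷ ys → a ∈ xs ++ c ∷ ys ⊎ a ≡ b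
∈-insert⁻ xs hl q with ∈-++⁻ xs q
∈-insert⁻ xs hl q | inj₁ q' = inj₁ (∈-++⁺ˡ q')
∈-insert⁻ xs hl q | inj₂ (there (there q')) = inj₁ (∈-++⁺ʳ xs (there q'))
∈-insert⁻ xs (inj₁ (refl , _)) q | inj₂ (here refl) = inj₁ (∈-++⁺ʳ xs (here refl))
∈-insert⁻ xs (inj₁ (_ , refl)) q | inj₂ (there (here refl)) = inj₂ refl
∈-insert⁻ xs (inj₂ (refl , _)) q | inj₂ (here refl) = inj₂ refl
∈-insert⁻ xs (inj₂ (_ , refl)) q | inj₂ (there (here refl)) = inj₁ (∈-++⁺ʳ xs (here refl))

-- The state of the scan from right to left: `E` has been connected and `P` is still to come.
Linked : List ℕ → List Chord → List Chord → Set
Linked ρ P E = Valid (P ++ E) × Good ρ (P ++ E) × Chained E × E ≢ []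

module _ {ρ : List ℕ} (descent : StartsWithDescent ρ) (bondless : NoDecreasingBond ρ) where

  module _ {P d A c B} (wide : Wide (P ++ d ∷ A ++ c ∷ B)) (valid : Valid (P ++ d ∷ A ++ c ∷ B))
           (good : Good ρ (P ++ d ∷ A ++ c ∷ B)) (chained : Chained (A ++ c ∷ B))
           (unlinked : ¬ Any (Crosses d) (A ++ c ∷ B)) where
    open Wide wide
    open Valid valid

    private
      E₂ E : List Chord
      E₂ = A ++ c ∷ B
      E = P ++ d ∷ E₂
      d∈ : d ∈ E
      d∈ = ∈-++⁺ʳ P (here refl)
      old : ∀ {a} → a ∈ E₂ → a ∈ E
      old a∈ = ∈-++⁺ʳ P (there a∈)
      ep : ∀ {a} → a ∈ E → Endpoint E (p a)
      ep a∈ = _ , a∈ , inj₁ refl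
      ev : ∀ {a} → a ∈ E → Endpoint E (v a)
      ev a∈ = _ , a∈ , inj₂ refl
      after-d : ∀ {a} → a ∈ E₂ → p a < p d
      after-d a∈ with h ∷ _ ← AllPairs-⊆ (Sub.++⁺ˡ P Sub.⊆-refl) descending = All.lookup h a∈
      before-d : ∀ {a} → a ∈ P → p d < p a
      before-d a∈ = AllPairs-across P descending a∈ (here refl)
      above-d : ∀ {a} → a ∈ E → p d < v a → suc (p d) < v a
      above-d a∈ lt = <-trans (n<1+n _) (gap (ep d∈) (ev a∈) lt)
      -- As `d` crosses no later chord, a later chord either ends before `d` begins or encloses `d`.
      dichotomy : ∀ {a} → a ∈ E₂ → v a < p d ⊎ v d < v a
      dichotomy {a} a∈ with <-cmp (v a) (p d) | <-cmp (v a) (v d)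
      ... | tri< lt _ _ | _ = inj₁ lt
      ... | tri≈ _ eq _ | _ = contradiction (sym eq) (p≢v d∈ (old a∈))
      ... | tri> _ _ _ | tri> _ _ gt = inj₂ gt
      ... | tri> _ _ _ | tri≈ _ eq _ = contradiction (cong p (v-inj (old a∈) d∈ eq)) (<⇒≢ (after-d a∈))
      ... | tri> _ _ gt | tri< lt _ _ = contradiction (lose a∈ (after-d a∈ , gt , lt)) unlinked
      no-suc : ∀ {e f} → Endpoint E e → Endpoint E f → e ≢ suc f
      no-suc e∈ f∈ refl = <-asym (gap f∈ e∈ (n<1+n _)) (≤-refl)
      above-d⇒ : ∀ {a} → a ∈ E₂ → p d < v a → v d < v a
      above-d⇒ a∈ lt with dichotomy a∈
      ... | inj₁ lt' = contradiction lt (<-asym lt')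
      ... | inj₂ gt = gt
      c∈ : c ∈ E₂
      c∈ = ∈-++⁺ʳ A (here refl)
      reassoc : (P ++ d ∷ A) ++ c ∷ B ≡ P ++ d ∷ A ++ c ∷ B
      reassoc = ++-assoc P (d ∷ A) (c ∷ B)
      desc : Descending p ((P ++ d ∷ A) ++ c ∷ B)
      desc = subst (Descending p) (sym reassoc) descending
      in-E₂ : ∀ {a} → a ∈ A ⊎ a ∈ B → a ∈ A ++ c ∷ B
      in-E₂ (inj₁ q) = ∈-++⁺ˡ q
      in-E₂ (inj₂ q) = ∈-++⁺ʳ A (there q)
      after-c : ∀ {a} → a ∈ B → p a < p c
      after-c q with h ∷ _ ← AllPairs-⊆ (Sub.++⁺ˡ (P ++ d ∷ A) Sub.⊆-refl) desc = All.lookup h q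
      before-c : ∀ {a} → a ∈ P ++ d ∷ A → p c < p a
      before-c q = AllPairs-across (P ++ d ∷ A) desc q (here refl)
      ≢c : ∀ {a} → a ∈ A ⊎ a ∈ B → v a ≢ v c
      ≢c (inj₁ q) eq = <⇒≢ (before-c (∈-++⁺ʳ P (there q))) (cong p (sym (v-inj (old (in-E₂ (inj₁ q))) (old c∈) eq)))
      ≢c (inj₂ q) eq = <⇒≢ (after-c q) (cong p (v-inj (old (in-E₂ (inj₂ q))) (old c∈) eq))
      beyond : ∀ {a} → a ∈ P → suc (p d) < p a
      beyond q = <-trans (n<1+n _) (gap (ep d∈) (ep (∈-++⁺ˡ q)) (before-d q))

    -- b = (p c - ε , p d + ε), for c the lowest chord around d.
    link-nested : v d < v c → (∀ {a} → a ∈ E₂ → v d < v a → v c ≤ v a) → ∃[ E' ] Linked ρ P E' × E ⊆ P ++ E'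
    link-nested vd<vc least with m , pc≡ ← p-pos (old c∈) =
      d ∷ A ++ c ∷ b ∷ B ,
      (subst Valid reassoc' valid' , subst (Good ρ) reassoc' good' ,
       (inj₂ (Any.++⁺ʳ A (there (here (<-trans pb<pc (after-d c∈) , n<1+n _ , above-d d∈ (p<v d∈))))) , chain') , λ ()) ,
      Sub.++⁺ (Sub.⊆-refl {x = P}) (refl ∷ ⊆-insert-after A)
      where
      b : Chord
      -- Distinct endpoints are at least three apart, so p c - 1 and p d + 1 are both free.
      b = m , suc (p d)
      pb<pc : m < p c
      pb<pc = subst (m <_) (sym pc≡) (n<1+n m)
      reassoc' : (P ++ d ∷ A) ++ c ∷ b ∷ B ≡ P ++ d ∷ A ++ c ∷ b ∷ B
      reassoc' = ++-assoc P (d ∷ A) (c ∷ b ∷ B)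
      pd<vc : p d < v c
      pd<vc = <-trans (p<v d∈) vd<vc
      before-b : ∀ {a} → a ∈ E → p a < p c → p a < m
      before-b {a} a∈ lt = s≤s⁻¹ (<-trans (n<1+n _) (subst (suc (suc (p a)) <_) pc≡ (gap (ep a∈) (ep (old c∈)) lt)))
      fresh : ∀ {a} → a ∈ (P ++ d ∷ A) ++ c ∷ B → p a ≢ suc (p d) × m ≢ v a × v a ≢ suc (p d)
      fresh {a} q = no-suc (ep a∈) (ep d∈) , (λ eq → no-suc (ep (old c∈)) (ev a∈) (trans pc≡ (cong suc eq))) , no-suc (ev a∈) (ep d∈)
        where a∈ = subst (a ∈_) reassoc q
      valid' : Valid ((P ++ d ∷ A) ++ c ∷ b ∷ B)
      valid' = valid-insert (subst Valid (sym reassoc) valid)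
        (descending-insert-after p (P ++ d ∷ A) desc pb<pc λ q → before-b (old (in-E₂ (inj₂ q))) (after-c q))
        (∈-insert⁻ (P ++ d ∷ A) (inj₁ (refl , refl)))
        (<-trans pb<pc (<-trans (after-d c∈) (n<1+n _)))
        fresh
      side : ∀ {a} → a ∈ A ⊎ a ∈ B → SameSide (v b) (v c) (v a)
      side q with dichotomy (in-E₂ q)
      ... | inj₁ lt = inj₁ (<-trans lt (n<1+n _) , <-trans lt pd<vc)
      -- As `c` is the lowest chord around `d`, any other chord around `d` ends above both `b` and
      -- `c`.
      ... | inj₂ gt = inj₂ (<-trans (above-d (old c∈) pd<vc) vc<va , vc<va)
        where vc<va = ≤∧≢⇒< (least (in-E₂ q) gt) (≢-sym (≢c q))
      good' : Good ρ ((P ++ d ∷ A) ++ c ∷ b ∷ B)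
      good' = good-insert descent bondless {P = P} (inj₁ (refl , refl)) (above-d (old c∈) pd<vc)
        (subst (Good ρ) (sym reassoc) good) valid'
        beyond above-d⇒ side
        (λ {a} q lt _ → ≤∧≢⇒< (subst (_≤ v a) (sym pc≡) lt) (p≢v (old c∈) (old (in-E₂ q))) ,
                        <-trans (after-d (in-E₂ q)) pd<vc)
        (p<v (old c∈))
      -- A chord crossed by `c` ends below `c`, hence below `d` by the choice of `c`, so `b` crosses
      -- it too.
      b-link : B ≡ [] ⊎ Any (Crosses c) B → B ≡ [] ⊎ Any (Crosses b) B
      b-link (inj₁ eq) = inj₁ eq
      b-link (inj₂ l) with e , e∈ , pe<pc , pc<ve , ve<vc ← find l with dichotomy (in-E₂ (inj₂ e∈))
      ... | inj₁ lt = inj₂ (lose e∈ (before-b (old (in-E₂ (inj₂ e∈))) pe<pc , <-trans pb<pc pc<ve , <-trans lt (n<1+n _)))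
      ... | inj₂ gt = contradiction ve<vc (≤⇒≯ (least (in-E₂ (inj₂ e∈)) gt))
      chain' : Chained (A ++ c ∷ b ∷ B)
      chain' = chained-insert-after A chained (pb<pc , <-trans (after-d c∈) (n<1+n _) , above-d (old c∈) pd<vc)
        (b-link (proj₁ (chained-++⁻ʳ A chained)))

    -- b = (p c + ε , p d + ε), for c the highest chord of E₂; all chords of E₂ are below d.
    link-disjoint : ¬ Any (λ a → v d < v a) E₂ → (∀ {a} → a ∈ E₂ → v a ≤ v c) → ∃[ E' ] Linked ρ P E' × E ⊆ P ++ E'
    link-disjoint none greatest =
      d ∷ A ++ b ∷ c ∷ B ,
      (subst Valid reassoc' valid' , subst (Good ρ) reassoc' good' ,
       (inj₂ (Any.++⁺ʳ A (here (pb<pd , n<1+n _ , above-d d∈ (p<v d∈)))) , chain') , λ ()) ,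
      Sub.++⁺ (Sub.⊆-refl {x = P}) (refl ∷ ⊆-insert-before A)
      where
      b : Chord
      b = suc (p c) , suc (p d)
      reassoc' : (P ++ d ∷ A) ++ b ∷ c ∷ B ≡ P ++ d ∷ A ++ b ∷ c ∷ B
      reassoc' = ++-assoc P (d ∷ A) (b ∷ c ∷ B)
      low : ∀ {a} → a ∈ A ++ c ∷ B → v a < p d
      low q with dichotomy q
      ... | inj₁ lt = lt
      ... | inj₂ gt = contradiction (lose q gt) none
      pc<vc : p c < v c
      pc<vc = p<v (old c∈)
      vc<vb : v c < suc (p d)
      vc<vb = <-trans (low c∈) (n<1+n _)
      pb<pd : suc (p c) < p d
      pb<pd = <-trans (n<1+n _) (gap (ep (old c∈)) (ep d∈) (after-d c∈))
      fresh : ∀ {a} → a ∈ (P ++ d ∷ A) ++ c ∷ B → p a ≢ suc (p d) × suc (p c) ≢ v a × v a ≢ suc (p d)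
      fresh {a} q = no-suc (ep a∈) (ep d∈) , ≢-sym (no-suc (ev a∈) (ep (old c∈))) , no-suc (ev a∈) (ep d∈)
        where a∈ = subst (a ∈_) reassoc q
      valid' : Valid ((P ++ d ∷ A) ++ b ∷ c ∷ B)
      valid' = valid-insert (subst Valid (sym reassoc) valid)
        (descending-insert-before p (P ++ d ∷ A) desc (n<1+n _) λ {a} q →
          <-trans (n<1+n _) (gap (ep (old c∈)) (ep (subst (a ∈_) reassoc (∈-++⁺ˡ q)))
            (before-c q)))
        (∈-insert⁻ (P ++ d ∷ A) (inj₂ (refl , refl)))
        (<-trans pb<pd (n<1+n _))
        fresh
      side : ∀ {a} → a ∈ A ⊎ a ∈ B → v a < v c
      side q = ≤∧≢⇒< (greatest (in-E₂ q)) (≢c q)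
      good' : Good ρ ((P ++ d ∷ A) ++ b ∷ c ∷ B)
      good' = good-insert descent bondless {P = P} (inj₂ (refl , refl)) vc<vb
        (subst (Good ρ) (sym reassoc) good) valid'
        beyond above-d⇒ (λ q → inj₁ (<-trans (side q) vc<vb , side q))
        (λ q lt _ → <-trans (n<1+n _) lt , <-trans (p<v (old (in-E₂ q))) (side q))
        pc<vc
      chain' : Chained (A ++ b ∷ c ∷ B)
      chain' = chained-insert-before A chained
        (n<1+n _ , <-trans (n<1+n _) (gap (ep (old c∈)) (ev (old c∈)) pc<vc) , vc<vb)

  -- If `d` already crosses a later chord, nothing is added. Otherwise a new chord ties it to the
  -- lowest chord enclosing it or, when there is none, to the highest of the later chords, all of
  -- which then lie below `d`.
  link : ∀ {P d E} → Wide (P ++ d ∷ E) → Valid (P ++ d ∷ E) → Good ρ (P ++ d ∷ E) → Chained E → E ≢ [] →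
         ∃[ E' ] Linked ρ P E' × P ++ d ∷ E ⊆ P ++ E'
  link {P} {d} {E} wide valid good chained E≢[] with Any.any? (λ a → (p a <? p d) ×-dec (p d <? v a) ×-dec (v a <? v d)) E
  ... | yes l = d ∷ E , (valid , good , (inj₂ l , chained) , λ ()) , Sub.⊆-refl
  ... | no unlinked with Any.any? (λ a → v d <? v a) E
  ...   | yes any with c , c∈ , vd<vc , least ← argmin-∈ (λ a → v d <? v a) v E any
                  with _ , _ , refl ← ∈-∃++ c∈ = link-nested {P = P} wide valid good chained unlinked vd<vc least
  ...   | no none with c , c∈ , greatest ← argmax-∈ v E E≢[]
                  with _ , _ , refl ← ∈-∃++ c∈ = link-disjoint {P = P} wide valid good chained unlinked none greatest

-- Stretching a diagram to make room

-- The factor 3 separates distinct endpoints by at least three, and the added 1 leaves a number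
-- below each endpoint, as `Wide` demands.
triple : ℕ → ℕ
triple x = suc (3 * x)

triple-mono : ∀ {x y} → x < y → triple x < triple y
triple-mono x<y = s≤s (*-monoʳ-< 3 x<y)

triple-cancel : ∀ {x y} → triple x < triple y → x < y
triple-cancel {x} {y} lt = *-cancelˡ-< 3 x y (s≤s⁻¹ lt)

triple-injective : ∀ {x y} → triple x ≡ triple y → x ≡ y
triple-injective {x} {y} eq = *-cancelˡ-≡ x y 3 (suc-injective eq)

stretch : Chord → Chord
stretch (x , y) = triple x , triple y

stretch-crosses : ∀ {a b} → Crosses a b → Crosses (stretch a) (stretch b)
stretch-crosses (l , m , n) = triple-mono l , triple-mono m , triple-mono n

stretch-chained : ∀ {E} → Chained E → Chained (map stretch E)
stretch-chained {[]} _ = tt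
stretch-chained {_ ∷ _} (inj₁ refl , ch) = inj₁ refl , ch
stretch-chained {_ ∷ _} (inj₂ l , ch) = inj₂ (Any.map⁺ (Any.map stretch-crosses l)) , stretch-chained ch

stretch-valid : ∀ {E} → Valid E → Valid (map stretch E)
stretch-valid {E} valid = record
  { descending = AllPairs.map⁺ (AllPairs.map triple-mono descending)
  ; p<v = λ a∈ → case₁ (∈-map⁻ stretch a∈)
  ; p≢v = λ a∈ b∈ → case₂ (∈-map⁻ stretch a∈) (∈-map⁻ stretch b∈)
  ; v-inj = λ a∈ b∈ → case₃ (∈-map⁻ stretch a∈) (∈-map⁻ stretch b∈)
  }
  where
  open Valid valid
  Stretched : Chord → Set
  Stretched a = ∃[ a' ] a' ∈ E × a ≡ stretch a'
  case₁ : ∀ {a} → Stretched a → p a < v a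
  case₁ (_ , a∈ , refl) = triple-mono (p<v a∈)
  case₂ : ∀ {a b} → Stretched a → Stretched b → p a ≢ v b
  case₂ (_ , a∈ , refl) (_ , b∈ , refl) eq = p≢v a∈ b∈ (triple-injective eq)
  case₃ : ∀ {a b} → Stretched a → Stretched b → v a ≡ v b → a ≡ b
  case₃ (_ , a∈ , refl) (_ , b∈ , refl) eq = cong stretch (v-inj a∈ b∈ (triple-injective eq))

stretch-wide : ∀ E → Wide (map stretch E)
stretch-wide E = record
  { gap = λ e f → gap' (endpoint e) (endpoint f)
  ; p-pos = λ a∈ → let a , _ , eq = ∈-map⁻ stretch a∈ in 3 * p a , cong p eq
  }
  where
  endpoint : ∀ {e} → Endpoint (map stretch E) e → ∃[ x ] e ≡ triple x
  endpoint (_ , a∈ , inj₁ refl) with a , _ , refl ← ∈-map⁻ stretch a∈ = p a , refl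
  endpoint (_ , a∈ , inj₂ refl) with a , _ , refl ← ∈-map⁻ stretch a∈ = v a , refl
  gap' : ∀ {e f} → ∃[ x ] e ≡ triple x → ∃[ y ] f ≡ triple y → e < f → suc (suc e) < f
  gap' (x , refl) (y , refl) lt = s≤s (subst (_≤ 3 * y) (*-suc 3 x) (*-monoʳ-≤ 3 (triple-cancel {x} {y} lt)))

st-stretch : ∀ s → st (map v (map stretch s)) ≡ st (map v s)
st-stretch s = trans (cong st (trans (sym (map-∘ s)) (map-∘ s)))
  (trans (st-cong triple id (map v s) λ _ _ → mk⇔ triple-cancel triple-mono) (cong st (map-id (map v s))))

stretch-good : ∀ {ρ E} → Good ρ E → Good ρ (map stretch E)
stretch-good good s⊆ clique eq with s , s⊆E , refl ← ⊆-map⁻ stretch s⊆ =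
  good s⊆E (λ a∈ b∈ → triple-cancel (clique (∈-map⁺ stretch a∈) (∈-map⁺ stretch b∈))) (trans (sym (st-stretch s)) eq)

-- Stretching alters the chords themselves, so inclusion persists only up to standardization of the
-- values.
Extends : List Chord → List Chord → Set
Extends E E' = ∀ {s} → s ⊆ E → ∃[ s' ] s' ⊆ E' × st (map v s') ≡ st (map v s)

extends-stretch : ∀ {E E'} → map stretch E ⊆ E' → Extends E E'
extends-stretch sub {s} s⊆ = map stretch s , Sub.⊆-trans (Sub.map⁺ stretch s⊆) sub , st-stretch s

extends-trans : ∀ {E F G} → Extends E F → Extends F G → Extends E G
extends-trans ef fg s⊆ with s' , s'⊆ , eq ← ef s⊆ with s'' , s''⊆ , eq' ← fg s'⊆ = s'' , s''⊆ , trans eq' eq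

-- Connecting the whole diagram

module _ {ρ : List ℕ} (descent : StartsWithDescent ρ) (bondless : NoDecreasingBond ρ) where

  -- Each round stretches the whole diagram and then links the last chord of `P`. As stretching also
  -- changes `P`, the induction runs on its length.
  link-all : ∀ n {P E} → length P ≡ n → Linked ρ P E → ∃[ E' ] Linked ρ [] E' × Extends (P ++ E) E'
  link-all zero {[]} {E} refl linked = E , linked , λ s⊆ → _ , s⊆ , refl
  link-all (suc n) {P} {E} len linked with initLast P
  ... | P' ∷ʳ′ d = extend (link descent bondless {P = map stretch P'} {d = stretch d} {E = map stretch E}
      (subst Wide shift (stretch-wide _)) (subst Valid shift (stretch-valid (proj₁ linked)))
      (subst (Good ρ) shift (stretch-good {ρ} (proj₁ (proj₂ linked))))
      (stretch-chained (proj₁ (proj₂ (proj₂ linked)))) (proj₂ (proj₂ (proj₂ linked)) ∘ map-≡[] E))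
    where
    shift : map stretch ((P' ++ d ∷ []) ++ E) ≡ map stretch P' ++ stretch d ∷ map stretch E
    shift = trans (cong (map stretch) (∷ʳ-++ P' d E)) (map-++ stretch P' (d ∷ E))
    len' : length (map stretch P') ≡ n
    len' = trans (length-map stretch P') (suc-injective (trans (sym (trans (length-++ P') (+-comm _ 1))) len))
    map-≡[] : ∀ E → map stretch E ≡ [] → E ≡ []
    map-≡[] [] _ = refl
    extend : (∃[ E₁ ] Linked ρ (map stretch P') E₁ × map stretch P' ++ stretch d ∷ map stretch E ⊆ map stretch P' ++ E₁) →
             ∃[ E' ] Linked ρ [] E' × Extends ((P' ++ d ∷ []) ++ E) E'
    extend (E₁ , linked₁ , sub) with E₂ , linked₂ , ext ← link-all n {map stretch P'} {E₁} len' linked₁ =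
      E₂ , linked₂ , extends-trans (extends-stretch (subst (_⊆ _) (sym shift) sub)) ext

  link-up : ∀ {E} → E ≢ [] → Valid E → Good ρ E → ∃[ E' ] Linked ρ [] E' × Extends E E'
  link-up {E} E≢[] valid good with initLast E
  ... | [] = contradiction refl E≢[]
  -- The scan starts from the rightmost chord, which is chained by itself.
  ... | P ∷ʳ′ d = link-all (length P) refl (valid , good , (inj₁ refl , tt) , λ ())

-- Permutations as chord diagrams

-- Every entry, including the minima, becomes a chord.  Its value y is coded as (n + 1) y + n
-- and its position as (n + 1) m + r, where m is the running minimum and r < n decreases to the
-- right, so that p a < v b says exactly that the running minimum at a is at most the value of b.
toChords : ℕ → ℕ → List ℕ → List Chord
toChords n m [] = []
toChords n m (y ∷ ys) = (suc n * (m ⊓ y) + length ys , suc n * y + n) ∷ toChords n (m ⊓ y) ys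

module _ (n : ℕ) where

  -- Codes compare like two-digit numbers in base n + 1. The last digit n of a value exceeds every
  -- `r`, so a tie k = y counts as smaller for the position.
  lex-< : ∀ {k y r} → k ≤ y → r < n → suc n * k + r < suc n * y + n
  lex-< k≤y r<n = +-mono-≤-< (*-monoʳ-≤ (suc n) k≤y) r<n

  lex-> : ∀ {k y} r → y < k → suc n * y + n < suc n * k + r
  lex-> {k} {y} r y<k = begin
    suc (suc n * y + n)  ≡⟨ trans (sym (+-suc (suc n * y) n)) (trans (+-comm (suc n * y) (suc n)) (sym (*-suc (suc n) y))) ⟩
    suc n * suc y        ≤⟨ *-monoʳ-≤ (suc n) y<k ⟩
    suc n * k            ≤⟨ m≤m+n (suc n * k) r ⟩
    suc n * k + r        ∎
    where open ≤-Reasoning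

  lex-<⁻ : ∀ {k y} r → suc n * k + r < suc n * y + n → k ≤ y
  lex-<⁻ r lt = ≮⇒≥ λ y<k → <-asym lt (lex-> r y<k)

  lex-≢ : ∀ {k y r} → r < n → suc n * k + r ≢ suc n * y + n
  lex-≢ {k} {y} {r} r<n eq with <-≤-connex y k
  ... | inj₂ k≤y = <⇒≢ (lex-< k≤y r<n) eq
  ... | inj₁ y<k = <⇒≢ (lex-> r y<k) (sym eq)

  height : ℕ → ℕ
  height y = suc n * y + n

  height-mono : ∀ {x y} → x < y → height x < height y
  height-mono {x} {y} lt = +-monoˡ-< n (*-monoʳ-< (suc n) lt)

  height-cancel : ∀ {x y} → height x < height y → x < y
  height-cancel {x} {y} lt = *-cancelˡ-< (suc n) x y (+-cancelʳ-< n _ _ lt)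

  v-toChords : ∀ m ys → map v (toChords n m ys) ≡ map height ys
  v-toChords m [] = refl
  v-toChords m (y ∷ ys) = cong (height y ∷_) (v-toChords (m ⊓ y) ys)

  st-height : ∀ ys → st (map height ys) ≡ st ys
  st-height ys = trans (st-cong height id ys λ _ _ → mk⇔ height-cancel height-mono) (cong st (map-id ys))

  toChords-bound : ∀ m ys {a} → a ∈ toChords n m ys → p a < suc n * m + length ys
  toChords-bound m (y ∷ ys) (here refl) = +-mono-≤-< (*-monoʳ-≤ (suc n) (m⊓n≤m m y)) ≤-refl
  toChords-bound m (y ∷ ys) (there q) = <-≤-trans (toChords-bound (m ⊓ y) ys q)
    (+-mono-≤ (*-monoʳ-≤ (suc n) (m⊓n≤m m y)) (n≤1+n _))

  toChords-descending : ∀ m ys → Descending p (toChords n m ys)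
  toChords-descending m [] = []
  toChords-descending m (y ∷ ys) = All.tabulate (toChords-bound (m ⊓ y) ys) ∷ toChords-descending (m ⊓ y) ys

  toChords-∈ : ∀ m ys → length ys ≤ n → ∀ {a} → a ∈ toChords n m ys →
               ∃[ k ] ∃[ r ] ∃[ y ] a ≡ (suc n * k + r , height y) × k ≤ y × r < n
  toChords-∈ m (y ∷ ys) len (here refl) = m ⊓ y , length ys , y , refl , m⊓n≤n m y , len
  toChords-∈ m (y ∷ ys) len (there q) = toChords-∈ (m ⊓ y) ys (<⇒≤ len) q

  toChords-valid : ∀ m {ys} → Unique ys → length ys ≤ n → Valid (toChords n m ys)
  toChords-valid m {ys} uniq len = record
    { descending = toChords-descending m ys
    ; p<v = λ q → below-own (toChords-∈ m ys len q)
    ; p≢v = λ q r → distinct (toChords-∈ m ys len q) (toChords-∈ m ys len r)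
    ; v-inj = λ q r eq → by-height eq (∈-AllPairs₂ heights q r)
    }
    where
    Shape : Chord → Set
    Shape a = ∃[ k ] ∃[ r ] ∃[ y ] a ≡ (suc n * k + r , height y) × k ≤ y × r < n
    below-own : ∀ {a} → Shape a → p a < v a
    below-own (_ , _ , _ , refl , k≤y , r<n) = lex-< k≤y r<n
    distinct : ∀ {a b} → Shape a → Shape b → p a ≢ v b
    distinct (_ , _ , _ , refl , _ , r<n) (_ , _ , _ , refl , _) = lex-≢ r<n
    heights : AllPairs (λ a b → v a ≢ v b) (toChords n m ys)
    heights = AllPairs.map⁻ (subst Unique (sym (v-toChords m ys))
      (AllPairs.map⁺ (AllPairs.map (λ x≢y eq → x≢y (*-cancelˡ-≡ _ _ (suc n) (+-cancelʳ-≡ n _ _ eq))) uniq)))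
    by-height : ∀ {a b} → v a ≡ v b → a ≡ b ⊎ v a ≢ v b ⊎ v b ≢ v a → a ≡ b
    by-height eq (inj₁ a≡b) = a≡b
    by-height eq (inj₂ (inj₁ ne)) = contradiction eq ne
    by-height eq (inj₂ (inj₂ ne)) = contradiction (sym eq) ne

  -- k is the running minimum of the original sequence up to the entry a; it either precedes
  -- the occurrence w ∷ ws or is its first entry.
  running-minimum : ∀ m ys {a s} → a ∷ s ⊆ toChords n m ys →
    ∃[ k ] ∃[ r ] ∃[ w ] ∃[ ws ] p a ≡ suc n * k + r × map v (a ∷ s) ≡ map height (w ∷ ws) ×
    (k ∷ w ∷ ws ⊆ m ∷ ys ⊎ (k ≡ w × w ∷ ws ⊆ ys))
  running-minimum m (y ∷ ys) (_ ∷ʳ τ) with running-minimum (m ⊓ y) ys τ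
  ... | k , r , w , ws , pa , eq , inj₂ (k≡w , σ) = k , r , w , ws , pa , eq , inj₂ (k≡w , y ∷ʳ σ)
  ... | k , r , w , ws , pa , eq , inj₁ σ with ⊓-sel m y
  ...   | inj₁ m⊓y≡m = k , r , w , ws , pa , eq , inj₁ (Sub.⊆-trans (subst (λ z → _ ⊆ z ∷ ys) m⊓y≡m σ) (refl ∷ y ∷ʳ Sub.⊆-refl))
  ...   | inj₂ m⊓y≡y = k , r , w , ws , pa , eq , inj₁ (m ∷ʳ subst (λ z → _ ⊆ z ∷ ys) m⊓y≡y σ)
  running-minimum m (y ∷ ys) {s = s} (refl ∷ τ)
    with ws , σ , eq ← ⊆-map⁻ height (subst (map v s ⊆_) (v-toChords (m ⊓ y) ys) (Sub.map⁺ v τ)) =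
    m ⊓ y , length ys , y , ws , refl , cong (height y ∷_) eq , which (⊓-sel m y)
    where
    which : m ⊓ y ≡ m ⊎ m ⊓ y ≡ y → m ⊓ y ∷ y ∷ ws ⊆ m ∷ y ∷ ys ⊎ (m ⊓ y ≡ y × y ∷ ws ⊆ y ∷ ys)
    which (inj₁ eq) = inj₁ (eq ∷ refl ∷ σ)
    which (inj₂ eq) = inj₂ (eq , refl ∷ σ)

-- A simple permutation above every member of the class

module _ {ρ : List ℕ} (descent : StartsWithDescent ρ) (bondless : NoDecreasingBond ρ) where

  -- In a clique the running minimum `k` at the first chord bounds all values of the copy of ρ from
  -- below. If it precedes the copy, it completes 1 ⊕ ρ; if it is the first entry of the copy, this
  -- contradicts ρ(1) ≥ 3.
  toChords-good : ∀ n y ys → Unique (y ∷ ys) → (∀ {s} → s ⊆ y ∷ ys → st s ≢ oneSum ρ) →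
                  Good ρ (toChords n y (y ∷ ys))
  toChords-good n y ys uniq avoids {[]} s⊆ clique eq with () ← large-head descent bondless eq
  toChords-good n y ys uniq avoids {a ∷ s} s⊆ clique eq
    with _ , _ , refl , two ← large-head descent bondless eq
    with k , r , w , ws , pa , heights , start ← running-minimum n y (y ∷ ys) s⊆ = conclude (distinct start)
    where
    minimal : ∀ {u} → u ∈ w ∷ ws → k ≤ u
    minimal {u} u∈ with b , b∈ , hu ← ∈-map⁻ v (subst (height n u ∈_) (sym heights) (∈-map⁺ (height n) u∈)) =
      lex-<⁻ n r (subst₂ _<_ pa (sym hu) (clique (here refl) b∈))
    distinct : k ∷ w ∷ ws ⊆ y ∷ y ∷ ys ⊎ (k ≡ w × w ∷ ws ⊆ y ∷ ys) → k ∷ w ∷ ws ⊆ y ∷ ys ⊎ k ≡ w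
    distinct (inj₁ (_ ∷ʳ σ)) = inj₁ σ
    distinct (inj₁ (refl ∷ _ ∷ʳ σ)) = inj₁ (refl ∷ σ)
    -- The initial running minimum repeats the first entry; an occurrence using both copies has `k`
    -- equal to `w`.
    distinct (inj₁ (refl ∷ refl ∷ _)) = inj₂ refl
    distinct (inj₂ (k≡w , _)) = inj₂ k≡w
    conclude : k ∷ w ∷ ws ⊆ y ∷ ys ⊎ k ≡ w → ⊥
    conclude (inj₁ σ) with k∉ ∷ _ ← AllPairs-⊆ σ uniq = avoids σ
      (trans (st-oneSum⁺ λ u∈ → ≤∧≢⇒< (minimal u∈) (All.lookup k∉ u∈))
        (cong oneSum (trans (sym (st-height n (w ∷ ws))) (trans (cong st (sym heights)) eq))))
    conclude (inj₂ refl) = contradiction two (subst (λ c → ¬ 2 ≤ c) (sym none) λ ())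
      where
      none : below (v a) (map v (a ∷ s)) ≡ 0
      none = below-none (map v (a ∷ s)) λ {x} x∈ x<a →
        let u , u∈ , x≡ = ∈-map⁻ (height n) (subst (x ∈_) heights x∈)
        in <⇒≱ (height-cancel n (subst₂ _<_ x≡ (∷-injectiveˡ heights) x<a)) (minimal u∈)

  embed : ∀ y ys → Unique (y ∷ ys) → (∀ {s} → s ⊆ y ∷ ys → st s ≢ oneSum ρ) →
          ∃[ τ ] IsSimple τ × Av (oneSum ρ) τ × st (y ∷ ys) ≼ τ
  embed y ys uniq avoids =
    finish (link-up descent bondless {E} (λ ()) (toChords-valid n y uniq ≤-refl) (toChords-good n y ys uniq avoids))
    where
    n = length (y ∷ ys)
    E = toChords n y (y ∷ ys)
    finish : ∃[ E' ] Linked ρ [] E' × Extends E E' → ∃[ τ ] IsSimple τ × Av (oneSum ρ) τ × st (y ∷ ys) ≼ τ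
    finish ([] , (_ , _ , _ , E≢[]) , _) = contradiction refl E≢[]
    finish (E'@(_ ∷ _) , (valid , good , chained , _) , extends) with s , s⊆E' , eq ← extends Sub.⊆-refl =
      st (map val (word E')) , word-simple valid chained (here refl) ,
      (st-IsPerm (word-unique E' valid) , word-avoids E' valid good) ,
      subst (_≼ st (map val (word E')))
        (trans (st-double (map v s)) (trans eq (trans (cong st (v-toChords n y (y ∷ ys))) (st-height n (y ∷ ys)))))
        (≼-st⁺ (chords⊆word E' valid s⊆E'))

  ∃-simple-above : ∀ {σ} → Av (oneSum ρ) σ → ∃[ τ ] IsSimple τ × Av (oneSum ρ) τ × σ ≼ τ
  -- The empty permutation lies below anything; a one-entry word supplies a simple permutation of
  -- the class.
  ∃-simple-above {[]} _ with τ , simple , av , _ ← embed 0 [] ([] ∷ []) (singleton-avoids descent) = τ , simple , av , [] , Sub.minimum τ , refl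
  ∃-simple-above {y ∷ ys} (perm , avoids) with τ , simple , av , occ ← embed y ys (IsPerm⇒Unique perm) (λ s⊆ eq → avoids (_ , s⊆ , eq)) =
    τ , simple , av , subst (_≼ τ) (IsPerm⇒st perm) occ

theorem3p6 : (ρ : List ℕ) → IsPerm ρ → StartsWithDescent ρ → NoDecreasingBond ρ
    → Ddagger (oneSum ρ) → ¬ Deflatable (Av (oneSum ρ))
theorem3p6 ρ _ descent bondless _ (D , (_ , D-closed) , _ , (σ , Cσ , σ∉D) , C⊆⟨D⟩)
  with τ , simple , Cτ , σ≼τ ← ∃-simple-above descent bondless Cσ =
  -- Being simple and contained in itself, `τ` belongs to `D`, and closure under containment brings
  -- `σ` into `D`.
  σ∉D (D-closed σ τ (proj₂ (C⊆⟨D⟩ τ Cτ) τ simple (τ , Sub.⊆-refl , IsPerm⇒st (proj₁ Cτ))) (proj₁ Cσ) σ≼τ)
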